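{- There exists a normal predicate modal logic which is Kripke complete, recursively enumerable, and not complete with respect to an elementary class of frames.
   Context: Predicate modal formulas use countably many individual variables, countably many predicate letters of each arity (including 0), $\neg,\wedge,\Box,\forall$. A normal predicate modal logic is a set of formulas containing all classical first-order validities and all formulas $\Box(\varphi\rightarrow\psi)\rightarrow(\Box\varphi\rightarrow\Box\psi)$, closed under predicate substitution, modus ponens, generalization ($\varphi\Rightarrow\forall y\,\varphi$) and necessitation ($\varphi\Rightarrow\Box\varphi$). A frame is $\langle W,R\rangle$ with $W\neq\emptyset$. Predicate frames assign nonempty domains $D(w)$ with $wRw'\Rightarrow D(w)\subseteq D(w')$; models interpret each $n$-ary letter at $w$ as a subset of $D(w)^n$; $\Box$ quantifies over $R$-successors and $\forall$ over $D(w)$. A formula is valid on a frame if true at every world under every assignment in every model over every predicate frame over it; $L(\mathfrak{C})$ is the set of formulas valid on every frame in $\mathfrak{C}$. A logic $L$ is complete with respect to $\mathfrak{C}$ if $L=L(\mathfrak{C})$, and Kripke complete if complete with respect to some class of frames. A class of frames is elementary if it consists exactly of the frames (as structures in signature $\{R,=\}$) satisfying some fixed closed first-order sentence. -}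

module Defs where

open import Level using (Level; _⊔_; 0ℓ; Lift) renaming (suc to lsuc)
open import Data.Nat using (ℕ; zero; suc; _+_; _≟_)
open import Data.Fin using (Fin)
import Data.Fin as Fin
import Data.Vec
open import Data.Vec using (Vec; []; _∷_; map)
open import Data.Maybe using (Maybe; just)
open import Data.Product using (Σ; _×_; _,_)
open import Data.Sum using (_⊎_)
open import Relation.Nullary using (¬_; yes; no)
open import Relation.Binary.PropositionalEquality using (_≡_)

-- Predicate modal formulas.
-- Individual variables are de Bruijn indices (ℕ); variable i free
-- in a formula refers to the i-th variable (after removing the
-- binders passed).  Predicate letters: letter k of arity n, applied
-- to a vector of n variables.  Connectives: ¬, ∧, □, ∀.

data Fm : Set where
  atom : (n k : ℕ) → Vec ℕ n → Fm
  ~_   : Fm → Fm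
  _∧'_ : Fm → Fm → Fm
  □_   : Fm → Fm
  ∀'_  : Fm → Fm

infixr 6 _∧'_
infixr 5 _⇒_

_⇒_ : Fm → Fm → Fm
φ ⇒ ψ = ~ (φ ∧' ~ ψ)

ext : (ℕ → ℕ) → ℕ → ℕ
ext ρ zero    = zero
ext ρ (suc i) = suc (ρ i)

rename : (ℕ → ℕ) → Fm → Fm
rename ρ (atom n k xs) = atom n k (map ρ xs)
rename ρ (~ φ)         = ~ rename ρ φ
rename ρ (φ ∧' ψ)      = rename ρ φ ∧' rename ρ ψ
rename ρ (□ φ)         = □ rename ρ φ
rename ρ (∀' φ)        = ∀' rename (ext ρ) φ

abstr : ℕ → ℕ → ℕ
abstr y i with i ≟ y
... | yes _ = zero
... | no  _ = suc i

∀[_]_ : ℕ → Fm → Fm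
∀[ y ] φ = ∀' rename (abstr y) φ

-- Predicate substitution.  σ n k is the formula substituted for the
-- n-ary letter k: its free variables 0,…,n-1 stand for the n
-- arguments, a free variable n+j is the parameter j (the j-th free
-- variable of the surrounding formula).  Simultaneous substitution
-- for all letters (σ n k = atom n k (0,…,n-1) leaves a letter fixed).
-- pick xs d i : the i-th argument if i < n, else the parameter
-- (i - n) seen under d binders, i.e. (i - n) + d.
pick : ∀ {n} → Vec ℕ n → ℕ → ℕ → ℕ
pick []       d i       = i + d
pick (x ∷ xs) d zero    = x
pick (x ∷ xs) d (suc i) = pick xs d i

PSub : Set
PSub = (n k : ℕ) → Fm

substAt : PSub → ℕ → Fm → Fm
substAt σ d (atom n k xs) = rename (pick xs d) (σ n k)
substAt σ d (~ φ)         = ~ substAt σ d φ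
substAt σ d (φ ∧' ψ)      = substAt σ d φ ∧' substAt σ d ψ
substAt σ d (□ φ)         = □ substAt σ d φ
substAt σ d (∀' φ)        = ∀' substAt σ (suc d) φ

psubst : PSub → Fm → Fm
psubst σ = substAt σ zero

data BoxFree : Fm → Set where
  atom : ∀ n k xs → BoxFree (atom n k xs)
  ~_   : ∀ {φ} → BoxFree φ → BoxFree (~ φ)
  _∧'_ : ∀ {φ ψ} → BoxFree φ → BoxFree ψ → BoxFree (φ ∧' ψ)
  ∀'_  : ∀ {φ} → BoxFree φ → BoxFree (∀' φ)

_∷ₐ_ : {A : Set} → A → (ℕ → A) → ℕ → A
(a ∷ₐ g) zero    = a
(a ∷ₐ g) (suc i) = g i

record Structure : Set₁ where
  field
    Dom  : Set
    elt  : Dom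
    Int  : (n k : ℕ) → Vec Dom n → Set

module _ (M : Structure) where
  open Structure M
  FOSat : (ℕ → Dom) → Fm → Set
  FOSat g (atom n k xs) = Int n k (map g xs)
  FOSat g (~ φ)         = ¬ FOSat g φ
  FOSat g (φ ∧' ψ)      = FOSat g φ × FOSat g ψ
  FOSat g (□ φ)         = FOSat g φ   -- irrelevant: only used on □-free formulas
  FOSat g (∀' φ)        = (a : Dom) → FOSat (a ∷ₐ g) φ

FOValid : Fm → Set₁
FOValid φ = BoxFree φ × ((M : Structure) (g : ℕ → Structure.Dom M) → FOSat M g φ)

NormalLogic : ∀ {ℓ} → (Fm → Set ℓ) → Set (lsuc 0ℓ ⊔ ℓ)
NormalLogic L =
    (∀ φ → FOValid φ → L φ)
  × (∀ φ ψ → L (□ (φ ⇒ ψ) ⇒ (□ φ ⇒ □ ψ)))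
  × (∀ σ φ → L φ → L (psubst σ φ))
  × (∀ φ ψ → L (φ ⇒ ψ) → L φ → L ψ)
  × (∀ y φ → L φ → L (∀[ y ] φ))
  × (∀ φ → L φ → L (□ φ))

record Frame : Set₁ where
  field
    W : Set
    w₀ : W
    R : W → W → Set

-- A predicate frame over F together with a model: a universe U,
-- nonempty domains D w ⊆ U, increasing along R, and interpretations
-- of n-ary letters at w as subsets of D(w)^n.
record Model (F : Frame) : Set₁ where
  open Frame F
  field
    U      : Set
    D      : W → U → Set
    D-ne   : ∀ w → Σ U (D w)
    D-mono : ∀ {w w'} → R w w' → ∀ {a} → D w a → D w' a
    I      : W → (n k : ℕ) → Vec U n → Set
    I-dom  : ∀ {w n k xs} → I w n k xs → ∀ (i : Fin n) → D w (Data.Vec.lookup xs i)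

module _ {F : Frame} (M : Model F) where
  open Frame F
  open Model M
  Sat : W → (ℕ → U) → Fm → Set
  Sat w g (atom n k xs) = I w n k (map g xs)
  Sat w g (~ φ)         = ¬ Sat w g φ
  Sat w g (φ ∧' ψ)      = Sat w g φ × Sat w g ψ
  Sat w g (□ φ)         = ∀ v → R w v → Sat v g φ
  Sat w g (∀' φ)        = ∀ a → D w a → Sat w (a ∷ₐ g) φ

ValidOn : Frame → Fm → Set₁
ValidOn F φ = (M : Model F) (w : Frame.W F) (g : ℕ → Model.U M) →
              (∀ i → Model.D M w (g i)) → Sat M w g φ

FrameClass : Set₂
FrameClass = Frame → Set₁

LogicOf : FrameClass → Fm → Set₁
LogicOf C φ = (F : Frame) → C F → ValidOn F φ

_≐_ : ∀ {a b} → (Fm → Set a) → (Fm → Set b) → Set (a ⊔ b)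
L ≐ L' = ∀ φ → (L φ → L' φ) × (L' φ → L φ)

KripkeComplete : ∀ {ℓ} → (Fm → Set ℓ) → Set (lsuc (lsuc 0ℓ) ⊔ ℓ)
KripkeComplete L = Σ FrameClass λ C → L ≐ LogicOf C

data FOF (n : ℕ) : Set where
  rel   : Fin n → Fin n → FOF n
  eq    : Fin n → Fin n → FOF n
  neg   : FOF n → FOF n
  conj  : FOF n → FOF n → FOF n
  all   : FOF (suc n) → FOF n

Sentence : Set
Sentence = FOF zero

consF : ∀ {n} {A : Set} → A → (Fin n → A) → Fin (suc n) → A
consF a g Fin.zero    = a
consF a g (Fin.suc i) = g i

FrameSat : (F : Frame) → ∀ {n} → (Fin n → Frame.W F) → FOF n → Set
FrameSat F g (rel i j)  = Frame.R F (g i) (g j)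
FrameSat F g (eq i j)   = g i ≡ g j
FrameSat F g (neg θ)    = ¬ FrameSat F g θ
FrameSat F g (conj θ χ) = FrameSat F g θ × FrameSat F g χ
FrameSat F g (all θ)    = ∀ w → FrameSat F (consF w g) θ

Elementary : Sentence → FrameClass
Elementary θ F = Lift (lsuc 0ℓ) (FrameSat F (λ ()) θ)

ElementarilyComplete : ∀ {ℓ} → (Fm → Set ℓ) → Set (lsuc 0ℓ ⊔ ℓ)
ElementarilyComplete L = Σ Sentence λ θ → L ≐ LogicOf (Elementary θ)

-- Recursive enumerability: the set enumerated by an (Agda-definable,
-- hence computable) function e : ℕ → Maybe Fm.

Enumerated : (ℕ → Maybe Fm) → Fm → Set
Enumerated e φ = Σ ℕ λ m → e m ≡ just φ

LEM : Set₂
LEM = (P : Set₁) → P ⊎ ¬ P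

{-# OPTIONS --safe #-}
module Submission where

-- L is the logic of the disjoint union of all paths of even length that are symmetric but for their two
-- ends, which are dead.
--
-- Recursive enumerability.  A formula of modal depth d cannot see beyond distance d, so it suffices to test
-- it at the finitely many worlds whose halved distances to both ends are at most d + 1.  At a fixed world
-- of a computable finitely branching frame, a formula is valid iff its negation together with the Henkin
-- axioms has no propositional model, and by compactness this has a finite certificate.
--
-- Not elementary.  Suppose L is the logic of the frames of a sentence θ.  As L is consistent with long
-- paths between dead ends, some θ-frame contains a long one; L makes the frame symmetric away from dead
-- ends and allows at most two successors, so this path meets the rest of the frame in its dead ends only.
-- An Ehrenfeucht–Fraïssé game shows that θ survives the lengthening of the path by one point.  But then
-- a world reaches dead ends in an odd and in an even number of steps, which L forbids.

open import Defs
open import Level using (0ℓ; Lift; lift; lower) renaming (suc to lsuc)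
open import Data.Bool using (Bool; true; false; not; _∧_; if_then_else_)
import Data.Bool.Properties as Bool
open import Data.Empty using (⊥; ⊥-elim; ⊥-elim-irr)
open import Data.Fin using (Fin; toℕ; fromℕ<)
import Data.Fin as Fin
open import Data.Fin.Properties using (toℕ<n; toℕ-fromℕ<; toℕ-injective)
open import Data.List using (List; []; _∷_; _++_; cartesianProductWith; upTo)
import Data.List as List
open import Data.List.Membership.Propositional using (_∈_; find; lose)
open import Data.List.Membership.Propositional.Properties
  using (∈-map⁺; ∈-map⁻; ∈-cartesianProductWith⁺; ∈-upTo⁺; ∈-++⁺ˡ; ∈-++⁺ʳ)
open import Data.List.Properties using (∷-injectiveˡ; ∷-injectiveʳ)
open import Data.List.Relation.Unary.Any using (here; there; any?)
open import Data.Maybe using (Maybe; just; nothing; maybe; _>>=_)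
open import Data.Maybe.Properties using (just-injective)
open import Data.Nat
  using (ℕ; zero; suc; _+_; _*_; _∸_; _⊔_; _≤_; _<_; z≤n; s≤s; s≤s⁻¹; _≤?_)
open import Data.Nat.Properties
open import Data.Nat.Solver using (module +-*-Solver)
open import Data.Product using (Σ; ∃; _×_; _,_; proj₁; proj₂; uncurry; swap)
open import Data.Sum using (_⊎_; inj₁; inj₂; [_,_]′)
import Data.Sum as Sum
open import Data.Unit using (⊤; tt)
open import Data.Vec using (Vec; []; _∷_; map; lookup)
open import Data.Vec.Properties using (map-cong; map-∘; lookup-map)
open import Function using (_∘_; id)
open import Relation.Binary.Definitions using (tri<; tri≈; tri>)
open import Relation.Binary.PropositionalEquality
open import Relation.Nullary using (¬_; Dec; yes; no; Reflects; ofʸ; ofⁿ)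
open import Relation.Nullary.Decidable using (map′; _×-dec_)
open import Relation.Nullary.Reflects using (¬-reflects; _×-reflects_)

-- Classical reasoning

module Classical (lem : LEM) where

  em : (P : Set) → P ⊎ ¬ P
  em P with lem (Lift (lsuc 0ℓ) P)
  ... | inj₁ p  = inj₁ (lower p)
  ... | inj₂ ¬p = inj₂ (¬p ∘ lift)

  dne : {P : Set} → ¬ ¬ P → P
  dne {P} ¬¬p = [ id , ⊥-elim ∘ ¬¬p ]′ (em P)

  ¬∀⇒∃¬ : {A : Set} {P : A → Set} → ¬ (∀ a → P a) → Σ A λ a → ¬ P a
  ¬∀⇒∃¬ ¬∀ = dne λ ¬∃ → ¬∀ λ a → dne λ ¬p → ¬∃ (a , ¬p)

-- Coding of formulas by numbers

-- One step of Cantor's walk along the antidiagonals; from the end of one it passes to the start of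
-- the next.
next : ℕ × ℕ → ℕ × ℕ
next (zero  , b) = suc b , zero
next (suc a , b) = a , suc b

unpair : ℕ → ℕ × ℕ
unpair zero    = zero , zero
unpair (suc n) = next (unpair n)

unpair-onto-diagonal : ∀ s b a → b + a ≡ s → ∃ λ n → unpair n ≡ (a , b)
unpair-onto-diagonal s zero zero _ = zero , refl
unpair-onto-diagonal (suc s) zero (suc a) e
  with unpair-onto-diagonal s s zero (+-identityʳ s)
... | n , h = suc n , trans (cong next h) (cong (_, zero) (sym e))
unpair-onto-diagonal s (suc b) a e
  with unpair-onto-diagonal s b (suc a) (trans (+-suc b a) e)
... | n , h = suc n , cong next h

pair : ℕ → ℕ → ℕ
pair a b = proj₁ (unpair-onto-diagonal (b + a) b a refl)

unpair-pair : ∀ a b → unpair (pair a b) ≡ (a , b)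
unpair-pair a b = proj₂ (unpair-onto-diagonal (b + a) b a refl)

data Tree : Set where
  leaf : ℕ → Tree
  _·_  : Tree → Tree → Tree

infixr 5 _·_

node : (ℕ → Tree) → ℕ × ℕ → Tree
node r (zero  , b) = leaf b
node r (suc a , b) = r a · r b

-- Unpairing does not yield structurally smaller numbers, so decoding recurses on a height bound,
-- and `fromTree` stores the height beside the label.
toTreeUpTo : ℕ → ℕ → Tree
toTreeUpTo zero    = node leaf ∘ unpair
toTreeUpTo (suc h) = node (toTreeUpTo h) ∘ unpair

label : Tree → ℕ
label (leaf x) = pair zero x
label (t · u)  = pair (suc (label t)) (label u)

height : Tree → ℕ
height (leaf _) = zero
height (t · u)  = suc (height t ⊔ height u)

toTreeUpTo-label : ∀ t h → height t ≤ h → toTreeUpTo h (label t) ≡ t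
toTreeUpTo-label (leaf x) zero    _ = cong (node _) (unpair-pair zero x)
toTreeUpTo-label (leaf x) (suc h) _ = cong (node _) (unpair-pair zero x)
toTreeUpTo-label (t · u) (suc h) (s≤s t⊔u≤h) =
  trans (cong (node _) (unpair-pair (suc (label t)) (label u)))
        (cong₂ _·_ (toTreeUpTo-label t h (≤-trans (m≤m⊔n _ _) t⊔u≤h))
                   (toTreeUpTo-label u h (≤-trans (m≤n⊔m _ _) t⊔u≤h)))

toTree : ℕ → Tree
toTree = uncurry toTreeUpTo ∘ unpair

fromTree : Tree → ℕ
fromTree t = pair (height t) (label t)

toTree-fromTree : ∀ t → toTree (fromTree t) ≡ t
toTree-fromTree t = trans (cong (uncurry toTreeUpTo) (unpair-pair (height t) (label t)))
                          (toTreeUpTo-label t (height t) ≤-refl)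

encVec : ∀ {n} → Vec ℕ n → Tree
encVec []       = leaf 0
encVec (x ∷ xs) = leaf x · encVec xs

decVec : ∀ n → Tree → Vec ℕ n
decVec zero    _            = []
decVec (suc n) (leaf x · t) = x ∷ decVec n t
decVec (suc n) _            = 0 ∷ decVec n (leaf 0)

decVec-encVec : ∀ {n} (xs : Vec ℕ n) → decVec n (encVec xs) ≡ xs
decVec-encVec []       = refl
decVec-encVec (x ∷ xs) = cong (x ∷_) (decVec-encVec xs)

encFm : Fm → Tree
encFm (atom n k xs) = leaf 0 · leaf n · leaf k · encVec xs
encFm (~ φ)         = leaf 1 · encFm φ
encFm (φ ∧' ψ)      = leaf 2 · encFm φ · encFm ψ
encFm (□ φ)         = leaf 3 · encFm φ
encFm (∀' φ)        = leaf 4 · encFm φ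

decFm : Tree → Fm
decFm (leaf 0 · leaf n · leaf k · t) = atom n k (decVec n t)
decFm (leaf 1 · t)                   = ~ decFm t
decFm (leaf 2 · t · u)               = decFm t ∧' decFm u
decFm (leaf 3 · t)                   = □ decFm t
decFm (leaf 4 · t)                   = ∀' decFm t
-- A default makes decoding total, so every number names some formula.
decFm _                              = atom 0 0 []

decFm-encFm : ∀ φ → decFm (encFm φ) ≡ φ
decFm-encFm (atom n k xs) = cong (atom n k) (decVec-encVec xs)
decFm-encFm (~ φ)         = cong ~_ (decFm-encFm φ)
decFm-encFm (φ ∧' ψ)      = cong₂ _∧'_ (decFm-encFm φ) (decFm-encFm ψ)
decFm-encFm (□ φ)         = cong □_ (decFm-encFm φ)
decFm-encFm (∀' φ)        = cong ∀'_ (decFm-encFm φ)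

-- Propositional compactness

data Prop : Set where
  var   : ℕ → Prop
  true' : Prop
  neg   : Prop → Prop
  and   : Prop → Prop → Prop

eval : (ℕ → Bool) → Prop → Bool
eval v (var i)   = v i
eval v true'     = true
eval v (neg p)   = not (eval v p)
eval v (and p q) = eval v p ∧ eval v q

bound : Prop → ℕ
bound (var i)   = suc i
bound true'     = zero
bound (neg p)   = bound p
bound (and p q) = bound p ⊔ bound q

AgreeBelow : ℕ → (v v' : ℕ → Bool) → Set
AgreeBelow n v v' = ∀ i → i < n → v i ≡ v' i

eval-agree : ∀ {v v'} p → AgreeBelow (bound p) v v' → eval v p ≡ eval v' p
eval-agree (var i)   h = h i ≤-refl
eval-agree true'     h = refl
eval-agree (neg p)   h = cong not (eval-agree p h)
eval-agree (and p q) h =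
  cong₂ _∧_ (eval-agree p λ i i<p → h i (≤-trans i<p (m≤m⊔n _ _)))
            (eval-agree q λ i i<q → h i (≤-trans i<q (m≤n⊔m _ _)))

-- Both the index and the variables of the false constraint are bounded by `n`, so only the first
-- `n` bits of `v` matter. This makes `Closed` a decidable certificate of unsatisfiability.
Violated : (ℕ → Prop) → ℕ → (ℕ → Bool) → Set
Violated Γ n v = ∃ λ i → i < n × bound (Γ i) ≤ n × eval v (Γ i) ≡ false

Closed : (ℕ → Prop) → ℕ → Set
Closed Γ n = ∀ v → Violated Γ n v

-- Branching on the first bit leaves a property of `n` bits. Valuations are compared pointwise,
-- whence the hypothesis that `P` respects agreement.
∀-prefix? : ∀ n {P : (ℕ → Bool) → Set} → (∀ v → Dec (P v)) →
            (∀ {v v'} → AgreeBelow n v v' → P v → P v') → Dec (∀ v → P v)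
∀-prefix? zero P? resp = map′ (λ p v → resp (λ _ ()) p) (λ ∀P → ∀P _) (P? λ _ → false)
∀-prefix? (suc n) {P} P? resp =
  map′ (λ (t , f) v → join t f v (v zero) refl) (λ ∀P → (λ v → ∀P _) , (λ v → ∀P _))
       (extend? true ×-dec extend? false)
  where
  cons-agree : ∀ b {v v'} → AgreeBelow n v v' → AgreeBelow (suc n) (b ∷ₐ v) (b ∷ₐ v')
  cons-agree b h zero    _         = refl
  cons-agree b h (suc i) (s≤s i<n) = h i i<n
  extend? : ∀ b → Dec (∀ v → P (b ∷ₐ v))
  extend? b = ∀-prefix? n (λ v → P? (b ∷ₐ v)) (λ h → resp (cons-agree b h))
  uncons : ∀ {b} v → v zero ≡ b → AgreeBelow (suc n) (b ∷ₐ (v ∘ suc)) v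
  uncons v e zero    _ = sym e
  uncons v e (suc i) _ = refl
  join : (∀ v → P (true ∷ₐ v)) → (∀ v → P (false ∷ₐ v)) → ∀ v b → v zero ≡ b → P v
  join t f v true  e = resp (uncons v e) (t (v ∘ suc))
  join t f v false e = resp (uncons v e) (f (v ∘ suc))

closed? : ∀ Γ n → Dec (Closed Γ n)
closed? Γ n = ∀-prefix? n violated? respects
  where
  violated? : ∀ v → Dec (Violated Γ n v)
  violated? v = anyUpTo? (λ i → (bound (Γ i) ≤? n) ×-dec (eval v (Γ i) Bool.≟ false)) n
  respects : ∀ {v v'} → AgreeBelow n v v' → Violated Γ n v → Violated Γ n v'
  respects h (i , i<n , b≤n , e) =
    i , i<n , b≤n , trans (sym (eval-agree (Γ i) λ j j<b → h j (≤-trans j<b b≤n))) e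

module Compactness (lem : LEM) (Γ : ℕ → Prop) (¬closed : ∀ n → ¬ Closed Γ n) where
  open Classical lem

  restrict : (ℕ → Bool) → ℕ → List Bool
  restrict v zero    = []
  restrict v (suc n) = v n ∷ restrict v n

  restrict-agree : ∀ n {v v'} → restrict v n ≡ restrict v' n → AgreeBelow n v v'
  restrict-agree (suc n) e i (s≤s i≤n) with m≤n⇒m<n∨m≡n i≤n
  ... | inj₁ i<n  = restrict-agree n (∷-injectiveʳ e) i i<n
  ... | inj₂ refl = ∷-injectiveˡ e

  -- The nodes of the binary tree followed in König's lemma: every finite stage has a good valuation
  -- through the node. Bits are listed latest first.
  Extendible : ℕ → List Bool → Set
  Extendible k bs = ∀ n → ∃ λ v → ¬ Violated Γ n v × restrict v k ≡ bs

  violated-mono : ∀ {m n v} → m ≤ n → Violated Γ m v → Violated Γ n v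
  violated-mono m≤n (i , i<m , b≤m , e) = i , ≤-trans i<m m≤n , ≤-trans b≤m m≤n , e

  extend : ∀ k bs → Extendible k bs → ∃ λ b → Extendible (suc k) (b ∷ bs)
  extend k bs ext with em (Extendible (suc k) (true ∷ bs))
  ... | inj₁ ext-true  = true , ext-true
  ... | inj₂ ¬ext-true with ¬∀⇒∃¬ ¬ext-true
  ...   | m , ¬v = false , ext-false
    where
    ext-false : Extendible (suc k) (false ∷ bs)
    -- Stage `m` rules out the bit `true` and stage `n` is the one requested; their maximum serves
    -- both.
    ext-false n with ext (m ⊔ n)
    ... | v , good , e with v k in vk
    ...   | false = v , good ∘ violated-mono (m≤n⊔m m n) , cong₂ _∷_ vk e
    ...   | true  = ⊥-elim (¬v (v , good ∘ violated-mono (m≤m⊔n m n) , cong₂ _∷_ vk e))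

  branch : ∀ k → ∃ (Extendible k)
  branch zero    = [] , λ n → let v , good = ¬∀⇒∃¬ (¬closed n) in v , good , refl
  branch (suc k) = let bs , ext = branch k in _ , proj₂ (extend k bs ext)

  limit : ℕ → Bool
  limit k = let bs , ext = branch k in proj₁ (extend k bs ext)

  restrict-limit : ∀ k → restrict limit k ≡ proj₁ (branch k)
  restrict-limit zero    = refl
  restrict-limit (suc k) = cong (limit k ∷_) (restrict-limit k)

  -- The branch is inspected at a depth exceeding `i` and every variable of `Γ i`; the good
  -- valuation found there agrees with `limit` on `Γ i`.
  limit-satisfies : ∀ i → eval limit (Γ i) ≡ true
  limit-satisfies i with proj₂ (branch (suc i ⊔ bound (Γ i))) (suc i ⊔ bound (Γ i))
  ... | v , good , e with eval v (Γ i) in ev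
  ...   | true  = trans (eval-agree (Γ i) λ j j<b →
                    restrict-agree n (trans (restrict-limit n) (sym e)) j (≤-trans j<b (m≤n⊔m (suc i) _))) ev
    where n = suc i ⊔ bound (Γ i)
  ...   | false = ⊥-elim (good (i , m≤m⊔n _ (bound (Γ i)) , m≤n⊔m (suc i) _ , ev))

-- Computable frames with at most two successors per world

record Transition : Set₁ where
  field
    World     : Set
    origin    : World
    step      : World → Bool → Maybe World
    encWorld  : World → Tree
    decWorld  : Tree → World
    decWorld-encWorld : ∀ w → decWorld (encWorld w) ≡ w

  frame : Frame
  frame = record { W = World ; w₀ = origin ; R = λ w v → ∃ λ b → step w b ≡ just v }

Reflects-map : ∀ {P Q : Set} {b} → (P → Q) → (Q → P) → Reflects P b → Reflects Q b
Reflects-map f g (ofʸ p)  = ofʸ (f p)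
Reflects-map f g (ofⁿ ¬p) = ofⁿ (¬p ∘ g)

reflects-true : ∀ {P : Set} {b} → Reflects P b → b ≡ true → P
reflects-true (ofʸ p) _ = p

true-reflects : ∀ {P : Set} {b} → Reflects P b → P → b ≡ true
true-reflects (ofʸ _)  _ = refl
true-reflects (ofⁿ ¬p) p = ⊥-elim (¬p p)

-- Completeness for a computable finitely branching frame

module Henkin (T : Transition) (r : Transition.World T) where
  open Transition T

  -- wit w φ ρ is the Henkin witness for the failure of ∀' φ at w under ρ.
  data Par : Set
  data Env : Set

  data Par where
    var : ℕ → Par
    wit : World → Fm → Env → Par

  data Env where
    []  : Env
    _∷_ : Par → Env → Env

  -- Universal formulas count as propositional atoms of their own; only the axioms tie them to their
  -- instances.
  data Atom : Set where
    letter : (w : World) (n k : ℕ) → Vec Par n → Atom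
    univ   : World → Fm → Env → Atom

  -- A parameter instantiates universal formulas at the worlds reachable from its world of birth,
  -- here given by a path. This encodes increasing domains.
  data Axiom : Set where
    instantiate : Par → List Bool → Fm → Env → Axiom
    witness     : World → Fm → Env → Axiom

  -- Coding of parameters, atoms and axioms

  encPar : Par → Tree
  encEnv : Env → Tree
  encPar (var i)     = leaf i
  encPar (wit w φ ρ) = encWorld w · encFm φ · encEnv ρ
  encEnv []      = leaf 0
  encEnv (p ∷ ρ) = encPar p · encEnv ρ

  decPar : Tree → Par
  decEnv : Tree → Env
  decPar (leaf i)    = var i
  decPar (s · t · u) = wit (decWorld s) (decFm t) (decEnv u)
  decPar _           = var 0
  decEnv (leaf _) = []
  decEnv (s · t)  = decPar s ∷ decEnv t

  decPar-encPar : ∀ p → decPar (encPar p) ≡ p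
  decEnv-encEnv : ∀ ρ → decEnv (encEnv ρ) ≡ ρ
  decPar-encPar (var i) = refl
  decPar-encPar (wit w φ ρ)
    rewrite decWorld-encWorld w | decFm-encFm φ | decEnv-encEnv ρ = refl
  decEnv-encEnv []      = refl
  decEnv-encEnv (p ∷ ρ) = cong₂ _∷_ (decPar-encPar p) (decEnv-encEnv ρ)

  encPars : ∀ {n} → Vec Par n → Tree
  encPars []       = leaf 0
  encPars (p ∷ ps) = encPar p · encPars ps

  decPars : ∀ n → Tree → Vec Par n
  decPars zero    _        = []
  decPars (suc n) (s · t)  = decPar s ∷ decPars n t
  decPars (suc n) (leaf _) = var 0 ∷ decPars n (leaf 0)

  decPars-encPars : ∀ {n} (ps : Vec Par n) → decPars n (encPars ps) ≡ ps
  decPars-encPars []       = refl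
  decPars-encPars (p ∷ ps) = cong₂ _∷_ (decPar-encPar p) (decPars-encPars ps)

  encAtom : Atom → Tree
  encAtom (letter w n k ps) = leaf n · leaf k · encWorld w · encPars ps
  encAtom (univ w φ ρ)      = (leaf 0 · encFm φ) · encWorld w · encEnv ρ

  decAtom : Tree → Atom
  decAtom (leaf n · leaf k · s · t) = letter (decWorld s) n k (decPars n t)
  decAtom ((_ · u) · s · t)         = univ (decWorld s) (decFm u) (decEnv t)
  decAtom _                         = univ origin (decFm (leaf 0)) []

  decAtom-encAtom : ∀ a → decAtom (encAtom a) ≡ a
  decAtom-encAtom (letter w n k ps) rewrite decWorld-encWorld w | decPars-encPars ps = refl
  decAtom-encAtom (univ w φ ρ)
    rewrite decWorld-encWorld w | decFm-encFm φ | decEnv-encEnv ρ = refl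

  encPath : List Bool → Tree
  encPath []           = leaf 0
  encPath (true ∷ bs)  = leaf 0 · encPath bs
  encPath (false ∷ bs) = leaf 1 · encPath bs

  decPath : Tree → List Bool
  decPath (leaf _)     = []
  decPath (leaf 0 · t) = true ∷ decPath t
  decPath (_ · t)      = false ∷ decPath t

  decPath-encPath : ∀ bs → decPath (encPath bs) ≡ bs
  decPath-encPath []           = refl
  decPath-encPath (true ∷ bs)  = cong (true ∷_) (decPath-encPath bs)
  decPath-encPath (false ∷ bs) = cong (false ∷_) (decPath-encPath bs)

  encAxiom : Axiom → Tree
  encAxiom (instantiate p bs φ ρ) = leaf 0 · encPar p · encPath bs · encFm φ · encEnv ρ
  encAxiom (witness w φ ρ)        = leaf 1 · encWorld w · encFm φ · encEnv ρ

  decAxiom : Tree → Axiom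
  decAxiom (leaf 0 · s · t · u · v) = instantiate (decPar s) (decPath t) (decFm u) (decEnv v)
  decAxiom (leaf 1 · s · t · u)     = witness (decWorld s) (decFm t) (decEnv u)
  decAxiom _                        = witness origin (decFm (leaf 0)) []

  decAxiom-encAxiom : ∀ a → decAxiom (encAxiom a) ≡ a
  decAxiom-encAxiom (instantiate p bs φ ρ)
    rewrite decPar-encPar p | decPath-encPath bs | decFm-encFm φ | decEnv-encEnv ρ = refl
  decAxiom-encAxiom (witness w φ ρ)
    rewrite decWorld-encWorld w | decFm-encFm φ | decEnv-encEnv ρ = refl

  -- The empty environment is the canonical assignment of `var i` to `i`; other environments push
  -- finitely many values in front of it.
  look : Env → ℕ → Par
  look []      i       = var i
  look (p ∷ ρ) zero    = p
  look (p ∷ ρ) (suc i) = look ρ i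

  birth : Par → World
  birth (var i)     = r
  birth (wit w φ ρ) = w

  -- Paths list the latest move first, so that prolonging a path is a cons.
  run : World → List Bool → Maybe World
  run w []       = just w
  run w (b ∷ bs) = run w bs >>= λ v → step v b

  atomVar : Atom → Prop
  atomVar a = var (fromTree (encAtom a))

  -- A box becomes a conjunction over the two possible successors, a missing one contributing
  -- `true'`; no quantifier is unfolded, so the result is a finite propositional formula.
  translate : World → Fm → Env → Prop
  translate w (atom n k xs) ρ = atomVar (letter w n k (map (look ρ) xs))
  translate w (~ φ)         ρ = neg (translate w φ ρ)
  translate w (φ ∧' ψ)      ρ = and (translate w φ ρ) (translate w ψ ρ)
  translate w (□ φ)         ρ = and (maybe (λ v → translate v φ ρ) true' (step w true))
                                    (maybe (λ v → translate v φ ρ) true' (step w false))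
  translate w (∀' φ)        ρ = atomVar (univ w φ ρ)

  imp : Prop → Prop → Prop
  imp p q = neg (and p (neg q))

  axiom : Axiom → Prop
  axiom (instantiate p bs φ ρ) =
    maybe (λ w → imp (atomVar (univ w φ ρ)) (translate w φ (p ∷ ρ))) true' (run (birth p) bs)
  axiom (witness w φ ρ) = imp (translate w φ (wit w φ ρ ∷ ρ)) (atomVar (univ w φ ρ))

  -- Decoding is onto, so all axioms occur after the negated formula, and the sequence is
  -- satisfiable iff `φ` fails at `r` in some model.
  refutation : Fm → ℕ → Prop
  refutation φ zero    = neg (translate r φ [])
  refutation φ (suc m) = axiom (decAxiom (toTree m))

  eval-imp : ∀ {v} p q → eval v (imp p q) ≡ true → eval v p ≡ true → eval v q ≡ true
  eval-imp {v} p q h hp with eval v p | eval v q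
  ... | true | true = refl

  imp-eval : ∀ {v} p q → (eval v p ≡ true → eval v q ≡ true) → eval v (imp p q) ≡ true
  imp-eval {v} p q h with eval v p | eval v q
  ... | true  | true  = refl
  ... | true  | false = h refl
  ... | false | _     = refl

  □-reflects : ∀ {v w φ ρ} {P : World → Set} →
    (∀ u → ∃ (λ b → step w b ≡ just u) → Reflects (P u) (eval v (translate u φ ρ))) →
    Reflects (∀ u → ∃ (λ b → step w b ≡ just u) → P u) (eval v (translate w (□ φ) ρ))
  □-reflects {v} {w} {φ} {ρ} {P} h =
    Reflects-map (λ (t , f) u → λ { (true , e) → t u e ; (false , e) → f u e })
                 (λ H → (λ u e → H u (true , e)) , (λ u e → H u (false , e)))
                 (branch true (step w true) refl ×-reflects branch false (step w false) refl)
    where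
    branch : ∀ b s → step w b ≡ s → Reflects (∀ u → step w b ≡ just u → P u)
                                     (eval v (maybe (λ u → translate u φ ρ) true' s))
    branch b nothing  e = ofʸ λ u e' → ⊥-elim (case (trans (sym e) e'))
      where case : ∀ {u : World} → nothing ≡ just u → ⊥
            case ()
    branch b (just u) e = Reflects-map (λ p u' e' → subst P (just-injective (trans (sym e) e')) p) (λ H → H u e)
                                       (h u (b , e))

  Countermodel : Fm → Set₁
  Countermodel φ = Σ (Model frame) λ M → Σ (ℕ → Model.U M) λ g →
                   (∀ i → Model.D M r (g i)) × ¬ Sat M r g φ

  -- Soundness: every model yields a valuation satisfying the axioms

  module Soundness (lem : LEM) (M : Model frame) (g : ℕ → Model.U M)
                   (g∈D : ∀ i → Model.D M r (g i)) where
    open Classical lem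
    open Model M

    Witness : World → (ℕ → U) → Fm → Set
    Witness w h φ = Σ U λ a → D w a × ¬ Sat M w (a ∷ₐ h) φ

    -- A counterexample to the universal formula if there is one, otherwise any element of the
    -- domain. The decision is an argument so that proofs can match on it.
    choose : ∀ w h φ → Witness w h φ ⊎ ¬ Witness w h φ → U
    choose w h φ = [ proj₁ , (λ _ → proj₁ (D-ne w)) ]′

    ⟦_⟧  : Par → U
    ⟦_⟧* : Env → ℕ → U
    ⟦ var i ⟧     = g i
    ⟦ wit w φ ρ ⟧ = choose w ⟦ ρ ⟧* φ (em (Witness w ⟦ ρ ⟧* φ))
    ⟦ [] ⟧*    = g
    ⟦ p ∷ ρ ⟧* = ⟦ p ⟧ ∷ₐ ⟦ ρ ⟧*

    ⟦look⟧ : ∀ ρ i → ⟦ look ρ i ⟧ ≡ ⟦ ρ ⟧* i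
    ⟦look⟧ []      i       = refl
    ⟦look⟧ (p ∷ ρ) zero    = refl
    ⟦look⟧ (p ∷ ρ) (suc i) = ⟦look⟧ ρ i

    choose∈D : ∀ w h φ c → D w (choose w h φ c)
    choose∈D w h φ (inj₁ (_ , a∈D , _)) = a∈D
    choose∈D w h φ (inj₂ _)             = proj₂ (D-ne w)

    ⟦⟧∈D-birth : ∀ p → D (birth p) ⟦ p ⟧
    ⟦⟧∈D-birth (var i)     = g∈D i
    ⟦⟧∈D-birth (wit w φ ρ) = choose∈D w _ φ (em _)

    D-run : ∀ {a} w bs v → run w bs ≡ just v → D w a → D v a
    D-run w []       v refl d = d
    D-run w (b ∷ bs) v e    d with run w bs in e'
    ... | just u = D-mono (b , e) (D-run w bs u e' d)

    choose-sat : ∀ w h φ c → Sat M w (choose w h φ c ∷ₐ h) φ → Sat M w h (∀' φ)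
    choose-sat w h φ (inj₁ (_ , _ , ¬sat)) sat = ⊥-elim (¬sat sat)
    choose-sat w h φ (inj₂ none) _ a a∈D = dne λ ¬sat → none (a , a∈D , ¬sat)

    Holds : Atom → Set
    Holds (letter w n k ps) = I w n k (map ⟦_⟧ ps)
    Holds (univ w φ ρ)      = Sat M w ⟦ ρ ⟧* (∀' φ)

    bool : ∀ {P : Set} → P ⊎ ¬ P → Bool
    bool = [ (λ _ → true) , (λ _ → false) ]′

    bool-reflects : ∀ {P : Set} (c : P ⊎ ¬ P) → Reflects P (bool c)
    bool-reflects (inj₁ p)  = ofʸ p
    bool-reflects (inj₂ ¬p) = ofⁿ ¬p

    valuation : ℕ → Bool
    valuation c = bool (em (Holds (decAtom (toTree c))))

    atomVar-reflects : ∀ a → Reflects (Holds a) (eval valuation (atomVar a))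
    atomVar-reflects a =
      subst (λ a' → Reflects (Holds a') (eval valuation (atomVar a)))
            (trans (cong decAtom (toTree-fromTree (encAtom a))) (decAtom-encAtom a))
            (bool-reflects (em (Holds (decAtom (toTree (fromTree (encAtom a)))))))

    translate-reflects : ∀ w φ ρ → Reflects (Sat M w ⟦ ρ ⟧* φ) (eval valuation (translate w φ ρ))
    translate-reflects w (atom n k xs) ρ =
      subst (λ ps → Reflects (I w n k ps) (eval valuation (atomVar (letter w n k (map (look ρ) xs)))))
            (trans (sym (map-∘ ⟦_⟧ (look ρ) xs)) (map-cong (⟦look⟧ ρ) xs))
            (atomVar-reflects (letter w n k (map (look ρ) xs)))
    translate-reflects w (~ φ)    ρ = ¬-reflects (translate-reflects w φ ρ)
    translate-reflects w (φ ∧' ψ) ρ = translate-reflects w φ ρ ×-reflects translate-reflects w ψ ρ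
    translate-reflects w (□ φ)    ρ = □-reflects {w = w} {φ} {ρ} λ u _ → translate-reflects u φ ρ
    translate-reflects w (∀' φ)   ρ = atomVar-reflects (univ w φ ρ)

    -- Instantiation holds since a parameter lies in the domain of its birth and domains grow along
    -- paths; the witness axiom holds by the choice of the witness.
    axiom-true : ∀ a → eval valuation (axiom a) ≡ true
    axiom-true (instantiate p bs φ ρ) with run (birth p) bs in e
    ... | nothing = refl
    ... | just w  = imp-eval (atomVar (univ w φ ρ)) (translate w φ (p ∷ ρ)) λ h →
      true-reflects (translate-reflects w φ (p ∷ ρ))
        (reflects-true (atomVar-reflects (univ w φ ρ)) h ⟦ p ⟧ (D-run _ bs w e (⟦⟧∈D-birth p)))
    axiom-true (witness w φ ρ) = imp-eval (translate w φ (wit w φ ρ ∷ ρ)) (atomVar (univ w φ ρ)) λ h →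
      true-reflects (atomVar-reflects (univ w φ ρ))
        (choose-sat w ⟦ ρ ⟧* φ (em _) (reflects-true (translate-reflects w φ (wit w φ ρ ∷ ρ)) h))

    -- The valuation of the model satisfies all axioms, so the constraint it violates can only be
    -- the negation of `φ`.
    closed-sound : ∀ φ n → Closed (refutation φ) n → Sat M r g φ
    closed-sound φ n closed with closed valuation
    ... | zero  , _ , _ , e = reflects-true (translate-reflects r φ [])
                                (Bool.not-injective e)
    ... | suc m , _ , _ , e with trans (sym e) (axiom-true (decAxiom (toTree m)))
    ...   | ()

  -- The term model of a valuation satisfying the axioms

  module TermModel (v : ℕ → Bool) (axioms-true : ∀ a → eval v (axiom a) ≡ true) where

    Live : World → Par → Set
    Live w p = ∃ λ bs → run (birth p) bs ≡ just w

    live-step : ∀ p {w u b} → step w b ≡ just u → Live w p → Live u p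
    live-step p {b = b} e (bs , e') = b ∷ bs , trans (cong (_>>= λ u → step u b) e') e

    model : Model frame
    model = record
      { U = Par ; D = Live
      -- Any witness indexed by `w` is born there and lives there by the empty path.
      ; D-ne = λ w → wit w (atom 0 0 []) [] , [] , refl
      ; D-mono = λ (b , e) {p} → live-step p e
      ; I = λ w n k ps → (∀ i → Live w (lookup ps i)) × eval v (atomVar (letter w n k ps)) ≡ true
      ; I-dom = proj₁ }

    ≡true-reflects : ∀ b → Reflects (b ≡ true) b
    ≡true-reflects true  = ofʸ refl
    ≡true-reflects false = ofⁿ λ ()

    -- The truth lemma. At a quantifier, `instantiate` along the path that makes the parameter live
    -- gives one direction, and `witness` the other.
    sat-reflects : ∀ w φ ρ g → (∀ i → g i ≡ look ρ i) → (∀ i → Live w (g i)) →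
                   Reflects (Sat model w g φ) (eval v (translate w φ ρ))
    sat-reflects w (atom n k xs) ρ g g≗ρ live rewrite sym (map-cong g≗ρ xs) =
      Reflects-map (λ e → (λ i → subst (Live w) (sym (lookup-map i g xs)) (live (lookup xs i))) , e)
                   proj₂ (≡true-reflects _)
    sat-reflects w (~ φ)    ρ g g≗ρ live = ¬-reflects (sat-reflects w φ ρ g g≗ρ live)
    sat-reflects w (φ ∧' ψ) ρ g g≗ρ live =
      sat-reflects w φ ρ g g≗ρ live ×-reflects sat-reflects w ψ ρ g g≗ρ live
    sat-reflects w (□ φ)    ρ g g≗ρ live =
      □-reflects {w = w} {φ} {ρ} λ u (b , e) → sat-reflects u φ ρ g g≗ρ (λ i → live-step (g i) e (live i))
    sat-reflects w (∀' φ)   ρ g g≗ρ live = Reflects-map to from (≡true-reflects _)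
      where
      sub : ∀ p → Live w p → Reflects (Sat model w (p ∷ₐ g) φ) (eval v (translate w φ (p ∷ ρ)))
      sub p p-live = sat-reflects w φ (p ∷ ρ) (p ∷ₐ g)
        (λ { zero → refl ; (suc i) → g≗ρ i }) (λ { zero → p-live ; (suc i) → live i })
      to : eval v (atomVar (univ w φ ρ)) ≡ true → Sat model w g (∀' φ)
      to e p (bs , e') = reflects-true (sub p (bs , e'))
        (eval-imp (atomVar (univ w φ ρ)) (translate w φ (p ∷ ρ))
          (subst (λ m → eval v (maybe (λ w → imp (atomVar (univ w φ ρ)) (translate w φ (p ∷ ρ))) true' m) ≡ true)
                 e' (axioms-true (instantiate p bs φ ρ))) e)
      from : Sat model w g (∀' φ) → eval v (atomVar (univ w φ ρ)) ≡ true
      from sat = eval-imp (translate w φ (wit w φ ρ ∷ ρ)) (atomVar (univ w φ ρ))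
        (axioms-true (witness w φ ρ))
        (true-reflects (sub (wit w φ ρ) ([] , refl)) (sat (wit w φ ρ) ([] , refl)))

  -- Compactness provides a valuation satisfying the negation and all axioms; its term model refutes
  -- `φ` under the assignment `var`.
  closed-complete : LEM → ∀ φ → (∀ n → ¬ Closed (refutation φ) n) → Countermodel φ
  closed-complete lem φ ¬closed =
    model , var , var-live , λ sat →
      case (trans (sym (limit-satisfies 0))
                  (cong not (true-reflects (sat-reflects r φ [] var (λ _ → refl) var-live) sat)))
    where
    open Compactness lem (refutation φ) ¬closed
    open TermModel limit (λ a → trans
      (cong (eval limit ∘ axiom) (sym (trans (cong decAxiom (toTree-fromTree (encAxiom a))) (decAxiom-encAxiom a))))
      (limit-satisfies (suc (fromTree (encAxiom a)))))
    var-live : ∀ i → Live r (var i)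
    var-live i = [] , refl
    case : true ≡ false → ⊥
    case ()

-- The paths of even length

-- E a b has distance 2a from the left end and 2b from the right end of its path, O a b has 2a + 1 and 2b + 1.
data Position : Set where
  E O : ℕ → ℕ → Position

-- `true` moves towards the left end and `false` towards the right. The ends are the `E` positions
-- with a coordinate zero.
move : Position → Bool → Maybe Position
move (O a b)             true  = just (E a (suc b))
move (O a b)             false = just (E (suc a) b)
move (E (suc a) (suc b)) true  = just (O a (suc b))
move (E (suc a) (suc b)) false = just (O (suc a) b)
move (E zero b)          _     = nothing
move (E (suc a) zero)    _     = nothing

encPosition : Position → Tree
encPosition (E a b) = leaf 0 · leaf a · leaf b
encPosition (O a b) = leaf 1 · leaf a · leaf b

decPosition : Tree → Position
decPosition (leaf 0 · leaf a · leaf b) = E a b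
decPosition (_ · leaf a · leaf b)      = O a b
decPosition _                          = E 0 0

decPosition-encPosition : ∀ w → decPosition (encPosition w) ≡ w
decPosition-encPosition (E a b) = refl
decPosition-encPosition (O a b) = refl

evenPaths : Transition
evenPaths = record { World = Position ; origin = E 0 0 ; step = move
                   ; encWorld = encPosition ; decWorld = decPosition
                   ; decWorld-encWorld = decPosition-encPosition }

evenPathFrame : Frame
evenPathFrame = Transition.frame evenPaths

open Henkin evenPaths using (refutation; Countermodel; closed-complete)

-- Locality

depth : Fm → ℕ
depth (atom _ _ _) = zero
depth (~ φ)        = depth φ
depth (φ ∧' ψ)     = depth φ ⊔ depth ψ
depth (□ φ)        = suc (depth φ)
depth (∀' φ)       = depth φ

-- A shift of the frame that is a bounded morphism away from the points of grade 0; among these, the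
-- exceptional ones get the full universe as their domain, so that the pulled back domains increase.
record Shift (F : Frame) : Set where
  open Frame F
  field
    shift       : W → W
    grade       : W → ℕ
    exceptional : W → Bool
    graded      : ∀ {w} → 0 < grade w → exceptional w ≡ false
    grade-R     : ∀ {w v} → R w v → grade w ≤ suc (grade v)
    shift-R     : ∀ {w v} → R w v → exceptional v ≡ false → R (shift w) (shift v)
    lift-R      : ∀ {w v'} → 0 < grade w → R (shift w) v' → ∃ λ v → R w v × shift v ≡ v'
    R-ordinary  : ∀ {w v} → R w v → exceptional w ≡ false

module Pullback {F : Frame} (S : Shift F) (M : Model F) where
  open Frame F
  open Shift S
  open Model M

  D' : W → U → Set
  D' w a = if exceptional w then ⊤ else D (shift w) a

  D'-ne : ∀ w → Σ U (D' w)
  D'-ne w with exceptional w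
  ... | true  = proj₁ (D-ne w) , tt
  ... | false = D-ne (shift w)

  D'-mono : ∀ {w v} → R w v → ∀ {a} → D' w a → D' v a
  D'-mono {w} {v} e d rewrite R-ordinary e with exceptional v in ev
  ... | true  = tt
  ... | false = D-mono (shift-R e ev) d

  I' : W → (n k : ℕ) → Vec U n → Set
  I' w n k xs = if exceptional w then ⊥ else I (shift w) n k xs

  I'-dom : ∀ {w n k xs} → I' w n k xs → ∀ i → D' w (lookup xs i)
  I'-dom {w} p with exceptional w
  ... | true  = λ _ → tt
  ... | false = I-dom p

  pullback : Model F
  pullback = record { U = U ; D = D' ; D-ne = D'-ne ; D-mono = λ {w} {w'} → D'-mono {w} {w'} ; I = I'
                    ; I-dom = λ {w} → I'-dom {w} }

  -- Each box lowers the depth by one and the grade by at most one, so evaluation never meets a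
  -- world of grade 0.
  sat⇒ : ∀ w g φ → depth φ < grade w → Sat pullback w g φ → Sat M (shift w) g φ
  sat⇐ : ∀ w g φ → depth φ < grade w → Sat M (shift w) g φ → Sat pullback w g φ
  sat⇒ w g (atom n k xs) d s rewrite graded (≤-trans (s≤s z≤n) d) = s
  sat⇒ w g (~ φ) d s s' = s (sat⇐ w g φ d s')
  sat⇒ w g (φ ∧' ψ) d (s , t) = sat⇒ w g φ (≤-trans (s≤s (m≤m⊔n _ _)) d) s
                              , sat⇒ w g ψ (≤-trans (s≤s (m≤n⊔m (depth φ) _)) d) t
  sat⇒ w g (□ φ) d s v' e with lift-R (≤-trans (s≤s z≤n) d) e
  ... | v , e' , refl = sat⇒ v g φ (s≤s⁻¹ (≤-trans d (grade-R e'))) (s v e')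
  sat⇒ w g (∀' φ) d s a a∈D =
    sat⇒ w (a ∷ₐ g) φ d (s a (subst (λ b → if b then ⊤ else D (shift w) a) (sym (graded (≤-trans (s≤s z≤n) d))) a∈D))
  sat⇐ w g (atom n k xs) d s rewrite graded (≤-trans (s≤s z≤n) d) = s
  sat⇐ w g (~ φ) d s s' = s (sat⇒ w g φ d s')
  sat⇐ w g (φ ∧' ψ) d (s , t) = sat⇐ w g φ (≤-trans (s≤s (m≤m⊔n _ _)) d) s
                              , sat⇐ w g ψ (≤-trans (s≤s (m≤n⊔m (depth φ) _)) d) t
  sat⇐ w g (□ φ) d s v e = sat⇐ v g φ d' (s (shift v) (shift-R e (graded (≤-trans (s≤s z≤n) d'))))
    where d' = s≤s⁻¹ (≤-trans d (grade-R e))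
  sat⇐ w g (∀' φ) d s a a∈D =
    sat⇐ w (a ∷ₐ g) φ d (s a (subst (λ b → if b then ⊤ else D (shift w) a) (graded (≤-trans (s≤s z≤n) d)) a∈D))

unshift : (S : Shift evenPathFrame) → ∀ w φ → depth φ < Shift.grade S w →
          Countermodel (Shift.shift S w) φ → Countermodel w φ
unshift S w φ d (M , g , g∈D , ¬sat) = pullback , g ,
  (λ i → subst (λ b → if b then ⊤ else Model.D M (Shift.shift S w) (g i))
               (sym (Shift.graded S (≤-trans (s≤s z≤n) d))) (g∈D i)) ,
  ¬sat ∘ sat⇒ w g φ d
  where open Pullback S M

-- Lengthens the path by two points on the left. Only the old left end can change its behaviour, so
-- it is exceptional, and the grade is the halved distance to it.
leftShift : Shift evenPathFrame
leftShift = record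
  { shift = λ { (E a b) → E (suc a) b ; (O a b) → O (suc a) b }
  ; grade = λ { (E a b) → a ; (O a b) → a }
  ; exceptional = λ { (E zero b) → true ; (E (suc a) b) → false ; (O a b) → false }
  ; graded = λ { {E (suc a) b} _ → refl ; {O a b} _ → refl }
  ; grade-R = λ { {O a b} (true , refl) → n≤1+n a
                ; {O a b} (false , refl) → ≤-trans (n≤1+n a) (n≤1+n (suc a))
                ; {E (suc a) (suc b)} (true , refl) → ≤-refl
                ; {E (suc a) (suc b)} (false , refl) → n≤1+n (suc a) }
  ; shift-R = λ { {O zero b} (true , refl) ()
                ; {O (suc a) b} (true , refl) _ → true , refl
                ; {O zero b} (false , refl) _ → false , refl
                ; {O (suc a) b} (false , refl) _ → false , refl
                ; {E (suc a) (suc b)} (true , refl) _ → true , refl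
                ; {E (suc a) (suc b)} (false , refl) _ → false , refl }
  ; lift-R = λ { {O (suc a) b} _ (true , refl) → _ , (true , refl) , refl
               ; {O (suc a) b} _ (false , refl) → _ , (false , refl) , refl
               ; {E (suc a) (suc b)} _ (true , refl) → _ , (true , refl) , refl
               ; {E (suc a) (suc b)} _ (false , refl) → _ , (false , refl) , refl }
  ; R-ordinary = λ { {O a b} _ → refl ; {E (suc a) b} _ → refl }
  }

rightShift : Shift evenPathFrame
rightShift = record
  { shift = λ { (E a b) → E a (suc b) ; (O a b) → O a (suc b) }
  ; grade = λ { (E a b) → b ; (O a b) → b }
  ; exceptional = λ { (E a zero) → true ; (E a (suc b)) → false ; (O a b) → false }
  ; graded = λ { {E a (suc b)} _ → refl ; {O a b} _ → refl }
  ; grade-R = λ { {O a b} (false , refl) → n≤1+n b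
                ; {O a b} (true , refl) → ≤-trans (n≤1+n b) (n≤1+n (suc b))
                ; {E (suc a) (suc b)} (false , refl) → ≤-refl
                ; {E (suc a) (suc b)} (true , refl) → n≤1+n (suc b) }
  ; shift-R = λ { {O a zero} (false , refl) ()
                ; {O a (suc b)} (false , refl) _ → false , refl
                ; {O a zero} (true , refl) _ → true , refl
                ; {O a (suc b)} (true , refl) _ → true , refl
                ; {E (suc a) (suc b)} (false , refl) _ → false , refl
                ; {E (suc a) (suc b)} (true , refl) _ → true , refl }
  ; lift-R = λ { {O a (suc b)} _ (false , refl) → _ , (false , refl) , refl
               ; {O a (suc b)} _ (true , refl) → _ , (true , refl) , refl
               ; {E (suc a) (suc b)} _ (false , refl) → _ , (false , refl) , refl
               ; {E (suc a) (suc b)} _ (true , refl) → _ , (true , refl) , refl }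
  ; R-ordinary = λ { {O a b} _ → refl ; {E (suc a) (suc b)} _ → refl ; {E zero (suc b)} _ → refl
                   ; {E zero zero} (true , ()) ; {E (suc a) zero} (true , ()) }
  }

-- As long as the coordinate exceeds `depth φ + 1`, its predecessor still exceeds the depth and
-- `drop` applies.
lower-coordinate : ∀ (C : ℕ → ℕ → Position) φ →
                   (∀ a b → depth φ < a → Countermodel (C (suc a) b) φ → Countermodel (C a b) φ) →
                   ∀ a b → Countermodel (C a b) φ → ∃ λ a' → a' ≤ suc (depth φ) × Countermodel (C a' b) φ
lower-coordinate C φ drop zero    b c = zero , z≤n , c
lower-coordinate C φ drop (suc a) b c with ≤-<-connex (suc a) (suc (depth φ))
... | inj₁ a≤d       = suc a , a≤d , c
... | inj₂ (s≤s d<a) = lower-coordinate C φ drop a b (drop a b d<a c)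

grid : (ℕ → ℕ → Position) → ℕ → List Position
grid C n = cartesianProductWith C (upTo (suc n)) (upTo (suc n))

∈-grid : ∀ C {a b n} → a ≤ n → b ≤ n → C a b ∈ grid C n
∈-grid C a≤n b≤n = ∈-cartesianProductWith⁺ C (∈-upTo⁺ (s≤s a≤n)) (∈-upTo⁺ (s≤s b≤n))

positionsUpTo : ℕ → List Position
positionsUpTo n = grid E n ++ grid O n

-- The coordinates are lowered one after the other, so finitely many positions decide validity at
-- all.
countermodel-nearby : ∀ φ w → Countermodel w φ →
                      ∃ λ w' → w' ∈ positionsUpTo (suc (depth φ)) × Countermodel w' φ
countermodel-nearby φ (E a b) c =
  let a' , a'≤ , c'  = lower-coordinate E φ (λ a b d → unshift leftShift (E a b) φ d) a b c
      b' , b'≤ , c'' = lower-coordinate (λ b a → E a b) φ (λ b a d → unshift rightShift (E a b) φ d) b a' c'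
  in E a' b' , ∈-++⁺ˡ (∈-grid E a'≤ b'≤) , c''
countermodel-nearby φ (O a b) c =
  let a' , a'≤ , c'  = lower-coordinate O φ (λ a b d → unshift leftShift (O a b) φ d) a b c
      b' , b'≤ , c'' = lower-coordinate (λ b a → O a b) φ (λ b a d → unshift rightShift (O a b) φ d) b a' c'
  in O a' b' , ∈-++⁺ʳ (grid E (suc (depth φ))) (∈-grid O a'≤ b'≤) , c''

-- The enumeration

-- Iterated unpairing reads one certificate per position off a single number.
ClosedAll : Fm → List Position → ℕ → Set
ClosedAll φ []       n = ⊤
ClosedAll φ (w ∷ ws) n = Closed (refutation w φ) (proj₁ (unpair n)) × ClosedAll φ ws (proj₂ (unpair n))

closedAll? : ∀ φ ws n → Dec (ClosedAll φ ws n)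
closedAll? φ []       n = yes tt
closedAll? φ (w ∷ ws) n = closed? (refutation w φ) _ ×-dec closedAll? φ ws _

Certified : Fm → ℕ → Set
Certified φ = ClosedAll φ (positionsUpTo (suc (depth φ)))

certified? : ∀ φ n → Dec (Certified φ n)
certified? φ = closedAll? φ (positionsUpTo (suc (depth φ)))

emit : ∀ {P : Set} → Fm → Dec P → Maybe Fm
emit φ (yes _) = just φ
emit φ (no _)  = nothing

emit⁻ : ∀ {P : Set} {φ ψ} (P? : Dec P) → emit φ P? ≡ just ψ → P × φ ≡ ψ
emit⁻ (yes p) refl = p , refl

emit⁺ : ∀ {P : Set} φ (P? : Dec P) → P → emit φ P? ≡ just φ
emit⁺ φ (yes _) p = refl
emit⁺ φ (no ¬p) p = ⊥-elim (¬p p)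

enumeratedFm : ℕ → Fm
enumeratedFm m = decFm (toTree (proj₁ (unpair m)))

-- The index codes a formula together with a candidate certificate; the formula is emitted when the
-- certificate checks.
enumeration : ℕ → Maybe Fm
enumeration m = emit (enumeratedFm m) (certified? (enumeratedFm m) (proj₂ (unpair m)))

enumerated⇒certified : ∀ {φ} → Enumerated enumeration φ → ∃ (Certified φ)
enumerated⇒certified (m , e) =
  let c , φ≡ = emit⁻ (certified? (enumeratedFm m) (proj₂ (unpair m))) e
  in proj₂ (unpair m) , subst (λ φ → Certified φ (proj₂ (unpair m))) φ≡ c

certified⇒enumerated : ∀ {φ} → ∃ (Certified φ) → Enumerated enumeration φ
certified⇒enumerated {φ} (n , c) = m , (begin
  emit (enumeratedFm m) (certified? (enumeratedFm m) (proj₂ (unpair m)))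
    ≡⟨ cong₂ (λ ψ k → emit ψ (certified? ψ k)) fm (cong proj₂ (unpair-pair (fromTree (encFm φ)) n)) ⟩
  emit φ (certified? φ n)
    ≡⟨ emit⁺ φ (certified? φ n) c ⟩
  just φ ∎)
  where
  open ≡-Reasoning
  m = pair (fromTree (encFm φ)) n
  fm : enumeratedFm m ≡ φ
  fm = trans (cong (decFm ∘ toTree ∘ proj₁) (unpair-pair (fromTree (encFm φ)) n))
             (trans (cong decFm (toTree-fromTree (encFm φ))) (decFm-encFm φ))

closedAll-sound : LEM → ∀ φ {ws} n {w} → ClosedAll φ ws n → w ∈ ws → ¬ Countermodel w φ
closedAll-sound lem φ {w ∷ ws} n (c , _) (here refl) (M , g , g∈D , ¬sat) =
  ¬sat (Henkin.Soundness.closed-sound evenPaths w lem M g g∈D φ (proj₁ (unpair n)) c)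
closedAll-sound lem φ n (_ , cs) (there i) = closedAll-sound lem φ (proj₂ (unpair n)) cs i

closedAll-complete : LEM → ∀ φ ws → (∀ w → ¬ Countermodel w φ) → ∃ (ClosedAll φ ws)
closedAll-complete lem φ [] _ = zero , tt
closedAll-complete lem φ (w ∷ ws) valid
  with Classical.em lem (∃ (Closed (refutation w φ))) | closedAll-complete lem φ ws valid
... | inj₁ (k , c) | n , cs = pair k n , both
  where
  both : ClosedAll φ (w ∷ ws) (pair k n)
  both rewrite unpair-pair k n = c , cs
... | inj₂ ¬c | _ = ⊥-elim (valid w (closed-complete w lem φ λ n c → ¬c (n , c)))

EvenPathClass : FrameClass
EvenPathClass = _≡ evenPathFrame

-- A countermodel anywhere would move to a tested position, where the certificate excludes it;
-- conversely, validity at the tested positions yields certificates by completeness.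
enumerates-logic : LEM → Enumerated enumeration ≐ LogicOf EvenPathClass
enumerates-logic lem φ = to , from
  where
  open Classical lem
  to : Enumerated enumeration φ → LogicOf EvenPathClass φ
  to en _ refl M w g g∈D = dne λ ¬sat →
    let _ , w'∈ , c = countermodel-nearby φ w (M , g , g∈D , ¬sat)
        n , certified = enumerated⇒certified en
    in closedAll-sound lem φ n certified w'∈ c
  from : LogicOf EvenPathClass φ → Enumerated enumeration φ
  from valid = certified⇒enumerated (closedAll-complete lem φ _ λ w (M , g , g∈D , ¬sat) →
    ¬sat (valid _ refl M w g g∈D))

-- Logics of frame classes are normal

module _ {F : Frame} (M : Model F) where
  open Model M

  sat-rename⇒ : ∀ {w} ρ {g g'} φ → (∀ i → g (ρ i) ≡ g' i) → Sat M w g (rename ρ φ) → Sat M w g' φ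
  sat-rename⇐ : ∀ {w} ρ {g g'} φ → (∀ i → g (ρ i) ≡ g' i) → Sat M w g' φ → Sat M w g (rename ρ φ)
  ext-agree : ∀ ρ {g g' : ℕ → U} a → (∀ i → g (ρ i) ≡ g' i) → ∀ i → (a ∷ₐ g) (ext ρ i) ≡ (a ∷ₐ g') i
  ext-agree ρ a h zero    = refl
  ext-agree ρ a h (suc i) = h i
  sat-rename⇒ ρ {g} (atom n k xs) h s =
    subst (I _ n k) (trans (sym (map-∘ g ρ xs)) (map-cong h xs)) s
  sat-rename⇒ ρ (~ φ)    h s v       = s (sat-rename⇐ ρ φ h v)
  sat-rename⇒ ρ (φ ∧' ψ) h (s , t)   = sat-rename⇒ ρ φ h s , sat-rename⇒ ρ ψ h t
  sat-rename⇒ ρ (□ φ)    h s v e     = sat-rename⇒ ρ φ h (s v e)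
  sat-rename⇒ ρ (∀' φ)   h s a a∈D   = sat-rename⇒ (ext ρ) φ (ext-agree ρ a h) (s a a∈D)
  sat-rename⇐ ρ {g} (atom n k xs) h s =
    subst (I _ n k) (sym (trans (sym (map-∘ g ρ xs)) (map-cong h xs))) s
  sat-rename⇐ ρ (~ φ)    h s v       = s (sat-rename⇒ ρ φ h v)
  sat-rename⇐ ρ (φ ∧' ψ) h (s , t)   = sat-rename⇐ ρ φ h s , sat-rename⇐ ρ ψ h t
  sat-rename⇐ ρ (□ φ)    h s v e     = sat-rename⇐ ρ φ h (s v e)
  sat-rename⇐ ρ (∀' φ)   h s a a∈D   = sat-rename⇐ (ext ρ) φ (ext-agree ρ a h) (s a a∈D)

_⊕_ : ∀ {A : Set} {n} → Vec A n → (ℕ → A) → ℕ → A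
[]       ⊕ g = g
(x ∷ xs) ⊕ g = x ∷ₐ (xs ⊕ g)

pick-⊕ : ∀ {A : Set} {n} (xs : Vec ℕ n) d {g g₀ : ℕ → A} → (∀ i → g (i + d) ≡ g₀ i) →
         ∀ i → g (pick xs d i) ≡ (map g xs ⊕ g₀) i
pick-⊕ []       d h i       = h i
pick-⊕ (x ∷ xs) d h zero    = refl
pick-⊕ (x ∷ xs) d h (suc i) = pick-⊕ xs d h i

module Substitution {F : Frame} (M : Model F) (σ : PSub) (g₀ : ℕ → Model.U M) where
  open Model M

  -- Each letter denotes what its substituted formula defines under the fixed parameters `g₀`, cut
  -- down to the local domain.
  substModel : Model F
  substModel = record
    { U = U ; D = D ; D-ne = D-ne ; D-mono = D-mono
    ; I = λ w n k xs → (∀ i → D w (lookup xs i)) × Sat M w (xs ⊕ g₀) (σ n k)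
    ; I-dom = proj₁ }

  cons∈D : ∀ {w a} {g : ℕ → U} → D w a → (∀ i → D w (g i)) → ∀ i → D w ((a ∷ₐ g) i)
  cons∈D a∈D g∈D zero    = a∈D
  cons∈D a∈D g∈D (suc i) = g∈D i

  parameters : ∀ d {g : ℕ → U} a → (∀ i → g (i + d) ≡ g₀ i) → ∀ i → (a ∷ₐ g) (i + suc d) ≡ g₀ i
  parameters d {g} a h i = trans (cong (a ∷ₐ g) (+-suc i d)) (h i)

  -- `d` counts the binders passed; the second hypothesis says that beyond them the assignment still
  -- gives the parameters.
  subst⇒ : ∀ d {w g} φ → (∀ i → D w (g i)) → (∀ i → g (i + d) ≡ g₀ i) →
           Sat substModel w g φ → Sat M w g (substAt σ d φ)
  subst⇐ : ∀ d {w g} φ → (∀ i → D w (g i)) → (∀ i → g (i + d) ≡ g₀ i) →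
           Sat M w g (substAt σ d φ) → Sat substModel w g φ
  subst⇒ d (atom n k xs) g∈D h (_ , s) = sat-rename⇐ M (pick xs d) (σ n k) (pick-⊕ xs d h) s
  subst⇒ d (~ φ)    g∈D h s v     = s (subst⇐ d φ g∈D h v)
  subst⇒ d (φ ∧' ψ) g∈D h (s , t) = subst⇒ d φ g∈D h s , subst⇒ d ψ g∈D h t
  subst⇒ d (□ φ)    g∈D h s v e   = subst⇒ d φ (D-mono e ∘ g∈D) h (s v e)
  subst⇒ d (∀' φ)   g∈D h s a a∈D = subst⇒ (suc d) φ (cons∈D a∈D g∈D) (parameters d a h) (s a a∈D)
  subst⇐ d {w} {g} (atom n k xs) g∈D h s =
    (λ i → subst (D w) (sym (lookup-map i g xs)) (g∈D (lookup xs i))) ,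
    sat-rename⇒ M (pick xs d) (σ n k) (pick-⊕ xs d h) s
  subst⇐ d (~ φ)    g∈D h s v     = s (subst⇒ d φ g∈D h v)
  subst⇐ d (φ ∧' ψ) g∈D h (s , t) = subst⇐ d φ g∈D h s , subst⇐ d ψ g∈D h t
  subst⇐ d (□ φ)    g∈D h s v e   = subst⇐ d φ (D-mono e ∘ g∈D) h (s v e)
  subst⇐ d (∀' φ)   g∈D h s a a∈D = subst⇐ (suc d) φ (cons∈D a∈D g∈D) (parameters d a h) (s a a∈D)

module FirstOrder {F : Frame} (M : Model F) (w : Frame.W F) where
  open Model M

  structure : Structure
  structure = record { Dom = Σ U (D w) ; elt = D-ne w ; Int = λ n k xs → I w n k (map proj₁ xs) }

  fo⇒ : ∀ {φ} → BoxFree φ → ∀ h → FOSat structure h φ → Sat M w (proj₁ ∘ h) φ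
  fo⇐ : ∀ {φ} → BoxFree φ → ∀ h → Sat M w (proj₁ ∘ h) φ → FOSat structure h φ
  cons-proj₁ : ∀ {a : U} {a∈D : D w a} h i → (a ∷ₐ (proj₁ ∘ h)) i ≡ proj₁ {B = D w} (((a , a∈D) ∷ₐ h) i)
  cons-proj₁ h zero    = refl
  cons-proj₁ h (suc i) = refl
  sat-≗ : ∀ {g g'} φ → (∀ i → g i ≡ g' i) → Sat M w g φ → Sat M w g' φ
  -- The detour through `rename id φ` replaces function extensionality.
  sat-≗ {g} {g'} φ g≗g' s = sat-rename⇒ M id φ g≗g' (sat-rename⇐ M id φ (λ _ → refl) s)
  fo⇒ (atom n k xs) h s = subst (I w n k) (sym (map-∘ proj₁ h xs)) s
  fo⇒ (~ b)    h s v       = s (fo⇐ b h v)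
  fo⇒ (b ∧' c) h (s , t)   = fo⇒ b h s , fo⇒ c h t
  fo⇒ (∀'_ {φ} b) h s a a∈D = sat-≗ φ (sym ∘ cons-proj₁ h) (fo⇒ b ((a , a∈D) ∷ₐ h) (s (a , a∈D)))
  fo⇐ (atom n k xs) h s = subst (I w n k) (map-∘ proj₁ h xs) s
  fo⇐ (~ b)    h s v       = s (fo⇒ b h v)
  fo⇐ (b ∧' c) h (s , t)   = fo⇐ b h s , fo⇐ c h t
  fo⇐ (∀'_ {φ} b) h s (a , a∈D) = fo⇐ b ((a , a∈D) ∷ₐ h) (sat-≗ φ (cons-proj₁ h) (s a a∈D))

LogicOf-normal : LEM → ∀ C → NormalLogic (LogicOf C)
LogicOf-normal lem C = fo , distribution , substitution , modusPonens , generalization , necessitation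
  where
  open Classical lem
  fo : ∀ φ → FOValid φ → LogicOf C φ
  fo φ (b , valid) F _ M w g g∈D =
    FirstOrder.fo⇒ M w b (λ i → g i , g∈D i) (valid (FirstOrder.structure M w) _)
  distribution : ∀ φ ψ → LogicOf C (□ (φ ⇒ ψ) ⇒ (□ φ ⇒ □ ψ))
  distribution φ ψ F _ M w g g∈D (□imp , ¬imp) =
    ¬imp λ (□φ , ¬□ψ) → ¬□ψ λ v e → dne λ ¬ψ → □imp v e (□φ v e , ¬ψ)
  substitution : ∀ σ φ → LogicOf C φ → LogicOf C (psubst σ φ)
  substitution σ φ valid F c M w g g∈D =
    subst⇒ 0 φ g∈D (λ i → cong g (+-identityʳ i)) (valid F c substModel w g g∈D)
    where open Substitution M σ g
  modusPonens : ∀ φ ψ → LogicOf C (φ ⇒ ψ) → LogicOf C φ → LogicOf C ψ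
  modusPonens φ ψ imp valid F c M w g g∈D = dne λ ¬ψ → imp F c M w g g∈D (valid F c M w g g∈D , ¬ψ)
  generalization : ∀ y φ → LogicOf C φ → LogicOf C (∀[ y ] φ)
  generalization y φ valid F c M w g g∈D a a∈D =
    sat-rename⇐ M (abstr y) φ (λ _ → refl) (valid F c M w _ λ i → in-D (abstr y i))
    where
    in-D : ∀ i → Model.D M w ((a ∷ₐ g) i)
    in-D zero    = a∈D
    in-D (suc i) = g∈D i
  necessitation : ∀ φ → LogicOf C φ → LogicOf C (□ φ)
  necessitation φ valid F c M w g g∈D v e = valid F c M v g (Model.D-mono M e ∘ g∈D)

≐-normal : ∀ {a b} {L : Fm → Set a} {L' : Fm → Set b} → L ≐ L' → NormalLogic L' → NormalLogic L
≐-normal {L = L} {L'} eqv (fo , k , sub , mp , gen , nec) =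
    (λ φ v → from φ (fo φ v)) , (λ φ ψ → from _ (k φ ψ)) , (λ σ φ l → from _ (sub σ φ (to φ l)))
  , (λ φ ψ l l' → from ψ (mp φ ψ (to _ l) (to φ l'))) , (λ y φ l → from _ (gen y φ (to φ l)))
  , (λ φ l → from _ (nec φ (to φ l)))
  where
  to : ∀ φ → L φ → L' φ
  to φ = proj₁ (eqv φ)
  from : ∀ φ → L' φ → L φ
  from φ = proj₂ (eqv φ)

-- Ehrenfeucht–Fraïssé games

rank : ∀ {n} → FOF n → ℕ
rank (rel i j)  = zero
rank (eq i j)   = zero
rank (neg θ)    = rank θ
rank (conj θ χ) = rank θ ⊔ rank χ
rank (all θ)    = suc (rank θ)

-- A back-and-forth system: `Sim k` relates positions with `k` rounds left, and each quantifier
-- spends one round.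
record Game (F F' : Frame) : Set₁ where
  open Frame F
  open Frame F' renaming (W to W'; R to R')
  field
    Sim   : ℕ → ∀ {n} → (Fin n → W) → (Fin n → W') → Set
    rel⇒  : ∀ {k n} {g : Fin n → W} {g'} → Sim k g g' → ∀ i j → R (g i) (g j) → R' (g' i) (g' j)
    rel⇐  : ∀ {k n} {g : Fin n → W} {g'} → Sim k g g' → ∀ i j → R' (g' i) (g' j) → R (g i) (g j)
    eq⇒   : ∀ {k n} {g : Fin n → W} {g'} → Sim k g g' → ∀ i j → g i ≡ g j → g' i ≡ g' j
    eq⇐   : ∀ {k n} {g : Fin n → W} {g'} → Sim k g g' → ∀ i j → g' i ≡ g' j → g i ≡ g j
    forth : ∀ {k n} {g : Fin n → W} {g'} → Sim (suc k) g g' → ∀ w → ∃ λ w' → Sim k (consF w g) (consF w' g')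
    back  : ∀ {k n} {g : Fin n → W} {g'} → Sim (suc k) g g' → ∀ w' → ∃ λ w → Sim k (consF w g) (consF w' g')

  transfer⇒ : ∀ {k n} (θ : FOF n) {g g'} → rank θ ≤ k → Sim k g g' → FrameSat F g θ → FrameSat F' g' θ
  transfer⇐ : ∀ {k n} (θ : FOF n) {g g'} → rank θ ≤ k → Sim k g g' → FrameSat F' g' θ → FrameSat F g θ
  transfer⇒ (rel i j)  _ s = rel⇒ s i j
  transfer⇒ (eq i j)   _ s = eq⇒ s i j
  transfer⇒ (neg θ)    r s h h' = h (transfer⇐ θ r s h')
  transfer⇒ (conj θ χ) r s (h , h') =
    transfer⇒ θ (m⊔n≤o⇒m≤o _ _ r) s h , transfer⇒ χ (m⊔n≤o⇒n≤o (rank θ) _ r) s h'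
  transfer⇒ (all θ) (s≤s r) s h w' = let w , s' = back s w' in transfer⇒ θ r s' (h w)
  transfer⇐ (rel i j)  _ s = rel⇐ s i j
  transfer⇐ (eq i j)   _ s = eq⇐ s i j
  transfer⇐ (neg θ)    r s h h' = h (transfer⇒ θ r s h')
  transfer⇐ (conj θ χ) r s (h , h') =
    transfer⇐ θ (m⊔n≤o⇒m≤o _ _ r) s h , transfer⇐ χ (m⊔n≤o⇒n≤o (rank θ) _ r) s h'
  transfer⇐ (all θ) (s≤s r) s h w = let w' , s' = forth s w in transfer⇐ θ r s' (h w')

-- Distances on two segments

Pebbles : Set
Pebbles = ℕ × ℕ

-- b − a = b' − a'
Exact : Pebbles → Pebbles → Set
Exact (a , a') (b , b') = a + b' ≡ a' + b

Apart : ℕ → Pebbles → Pebbles → Set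
Apart T (a , a') (b , b') = a + T ≤ b × a' + T ≤ b'

-- The classical invariant on linear orders: equal signed distances, or distances of at least `T` in
-- the same direction.
Close : ℕ → Pebbles → Pebbles → Set
Close T P Q = Exact P Q ⊎ Apart T P Q ⊎ Apart T Q P

Exact-sym : ∀ P Q → Exact P Q → Exact Q P
Exact-sym (a , a') (b , b') e = trans (+-comm b a') (trans (sym e) (+-comm a b'))

Close-sym : ∀ {T} P Q → Close T P Q → Close T Q P
Close-sym P Q (inj₁ e)        = inj₁ (Exact-sym P Q e)
Close-sym P Q (inj₂ (inj₁ h)) = inj₂ (inj₂ h)
Close-sym P Q (inj₂ (inj₂ h)) = inj₂ (inj₁ h)

Close-refl : ∀ {T} P → Close T P P
Close-refl (a , a') = inj₁ (+-comm a a')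

Close-swap : ∀ {T} P Q → Close T P Q → Close T (swap P) (swap Q)
Close-swap P Q (inj₁ e)              = inj₁ (sym e)
Close-swap P Q (inj₂ (inj₁ (h , l))) = inj₂ (inj₁ (l , h))
Close-swap P Q (inj₂ (inj₂ (h , l))) = inj₂ (inj₂ (l , h))

Apart-mono : ∀ {S T P Q} → S ≤ T → Apart T P Q → Apart S P Q
Apart-mono {P = a , a'} S≤T (h , l) = ≤-trans (+-monoʳ-≤ a S≤T) h , ≤-trans (+-monoʳ-≤ a' S≤T) l

Close-mono : ∀ {S T P Q} → S ≤ T → Close T P Q → Close S P Q
Close-mono {P = P} {Q} S≤T = Sum.map₂ (Sum.map (Apart-mono {P = P} {Q} S≤T) (Apart-mono {P = Q} {P} S≤T))

Exact-trans : ∀ N P Q → Exact N P → Exact P Q → Exact N Q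
Exact-trans (a , a') (b , b') (c , c') h l = +-cancelʳ-≡ (b + b') _ _ (begin
  (a + c') + (b + b') ≡⟨ solve 4 (λ a c' b b' → (a :+ c') :+ (b :+ b') := (a :+ b') :+ (b :+ c')) refl a c' b b' ⟩
  (a + b') + (b + c') ≡⟨ cong₂ _+_ h l ⟩
  (a' + b) + (b' + c) ≡⟨ solve 4 (λ a' b b' c → (a' :+ b) :+ (b' :+ c) := (a' :+ c) :+ (b :+ b')) refl a' b b' c ⟩
  (a' + c) + (b + b') ∎)
  where open ≡-Reasoning
        open +-*-Solver

Exact-≤ : ∀ a a' b b' {T} → Exact (a , a') (b , b') → a ≤ b + T → a' ≤ b' + T
Exact-≤ a a' b b' {T} e a≤b+T = +-cancelʳ-≤ b _ _ (begin
  a' + b       ≡⟨ sym e ⟩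
  a + b'       ≤⟨ +-monoˡ-≤ b' a≤b+T ⟩
  b + T + b'   ≡⟨ solve 3 (λ b T b' → b :+ T :+ b' := b' :+ T :+ b) refl b T b' ⟩
  b' + T + b   ∎)
  where open ≤-Reasoning
        open +-*-Solver

Exact-≥ : ∀ a a' b b' {T} → Exact (a , a') (b , b') → b ≤ a + T → b' ≤ a' + T
Exact-≥ a a' b b' e = Exact-≤ b b' a a' (Exact-sym (a , a') (b , b') e)

apart-through : ∀ {a b c T} → a ≤ b + T → b + (T + T) ≤ c → a + T ≤ c
apart-through {a} {b} {c} {T} a≤b+T b+2T≤c = begin
  a + T       ≤⟨ +-monoˡ-≤ T a≤b+T ⟩
  b + T + T   ≡⟨ +-assoc b T T ⟩
  b + (T + T) ≤⟨ b+2T≤c ⟩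
  c           ∎
  where open ≤-Reasoning

apart-back : ∀ {a b c T} → b ≤ a + T → c + (T + T) ≤ b → c + T ≤ a
apart-back {a} {b} {c} {T} b≤a+T c+2T≤b = +-cancelʳ-≤ T _ _ (begin
  c + T + T   ≡⟨ +-assoc c T T ⟩
  c + (T + T) ≤⟨ c+2T≤b ⟩
  b           ≤⟨ b≤a+T ⟩
  a + T       ∎)
  where open ≤-Reasoning

-- Moving both components by the same amount of at most `T` leaves at least `T` of a gap of `T + T`.
exact-close : ∀ {T} N P Q → Exact N P → proj₁ N ≤ proj₁ P + T → proj₁ P ≤ proj₁ N + T →
              Close (T + T) P Q → Close T N Q
exact-close N P Q e _ _ (inj₁ e') = inj₁ (Exact-trans N P Q e e')
exact-close (a , a') (b , b') Q e a≤ b≤ (inj₂ (inj₁ (h , l))) =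
  inj₂ (inj₁ (apart-through a≤ h , apart-through (Exact-≤ a a' b b' e a≤) l))
exact-close (a , a') (b , b') Q e a≤ b≤ (inj₂ (inj₂ (h , l))) =
  inj₂ (inj₂ (apart-back b≤ h , apart-back (Exact-≥ a a' b b' e b≤) l))

Close-≤ : ∀ {T a a' b b'} → 0 < T → Close T (a , a') (b , b') → a ≤ b → a' ≤ b'
Close-≤ {a = a} {a'} {b} {b'} 0<T (inj₁ e) a≤b =
  ≤-trans (Exact-≤ a a' b b' {0} e (≤-trans a≤b (m≤m+n b 0))) (≤-reflexive (+-identityʳ b'))
Close-≤ 0<T (inj₂ (inj₁ (_ , l))) _ = ≤-trans (m≤m+n _ _) l
Close-≤ {T} {a} {a'} {b} 0<T (inj₂ (inj₂ (h , _))) a≤b =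
  ⊥-elim (<-irrefl refl (≤-trans (≤-trans (m<m+n b 0<T) h) a≤b))

Close-< : ∀ {T a a' b b'} → 0 < T → Close T (a , a') (b , b') → a < b → a' < b'
Close-< {a = a} {a'} {b} {b'} 0<T c a<b =
  ≰⇒> λ b'≤a' → <⇒≱ a<b (Close-≤ 0<T (Close-swap (b , b') (a , a') (Close-sym (a , a') (b , b') c)) b'≤a')

-- Pebbles on neighbouring points are less than `T` apart, so their distance is copied exactly.
Close-suc : ∀ {T a a' b b'} → 2 ≤ T → Close T (a , a') (b , b') → suc a ≡ b → suc a' ≡ b'
Close-suc {a = a} {a'} {b' = b'} _ (inj₁ e) refl = sym (+-cancelˡ-≡ a _ _ (begin
  a + b'     ≡⟨ e ⟩
  a' + suc a ≡⟨ +-comm a' (suc a) ⟩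
  suc a + a' ≡⟨ sym (+-suc a a') ⟩
  a + suc a' ∎))
  where open ≡-Reasoning
Close-suc {T} {a} 2≤T (inj₂ (inj₁ (h , _))) refl =
  ⊥-elim (<-irrefl refl (≤-trans (≤-trans (≤-reflexive (+-comm 2 a)) (+-monoʳ-≤ a 2≤T)) h))
Close-suc {T} {a} 2≤T (inj₂ (inj₂ (h , _))) refl =
  ⊥-elim (<-irrefl refl (≤-trans (m≤m+n (suc a) T) h))

Pairwise : ℕ → List Pebbles → Set
Pairwise T Ps = ∀ {P Q} → P ∈ Ps → Q ∈ Ps → Close T P Q

Near : ℕ → ℕ → Pebbles → Set
Near T a (b , _) = a ≤ b + T × b ≤ a + T

near? : ∀ T a P → Dec (Near T a P)
near? T a (b , _) = (a ≤? b + T) ×-dec (b ≤? a + T)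

∈-absorb : ∀ {A : Set} {x y : A} {xs} → y ∈ xs → x ∈ y ∷ xs → x ∈ xs
∈-absorb y∈ (here refl) = y∈
∈-absorb y∈ (there h)   = h

∈-insert : ∀ {A : Set} {x y z : A} {xs} → x ∈ y ∷ xs → x ∈ y ∷ z ∷ xs
∈-insert (here e)  = here e
∈-insert (there h) = there (there h)

highest-below : ∀ a B (Ps : List Pebbles) → proj₁ B ≤ a →
                ∃ λ Q → Q ∈ B ∷ Ps × proj₁ Q ≤ a × (∀ {S} → S ∈ B ∷ Ps → proj₁ S ≤ a → proj₁ S ≤ proj₁ Q)
highest-below a B []       B≤a = B , here refl , B≤a , λ { (here refl) _ → ≤-refl }
highest-below a B (P ∷ Ps) B≤a with highest-below a B Ps B≤a | proj₁ P ≤? a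
... | Q , Q∈ , Q≤a , max | no P≰a = Q , ∈-insert Q∈ , Q≤a ,
  λ { (here refl) → max (here refl) ; (there (here refl)) P≤a → ⊥-elim (P≰a P≤a) ; (there (there S∈)) → max (there S∈) }
... | Q , Q∈ , Q≤a , max | yes P≤a with ≤-total (proj₁ P) (proj₁ Q)
...   | inj₁ P≤Q = Q , ∈-insert Q∈ , Q≤a ,
  λ { (here refl) → max (here refl) ; (there (here refl)) _ → P≤Q ; (there (there S∈)) → max (there S∈) }
...   | inj₂ Q≤P = P , there (here refl) , P≤a ,
  λ { (here refl) B≤a → ≤-trans (max (here refl) B≤a) Q≤P ; (there (here refl)) _ → ≤-refl
    ; (there (there S∈)) S≤a → ≤-trans (max (there S∈) S≤a) Q≤P }

-- Duplicator's reply. If a pebble is within `T`, its offset is copied. Otherwise the reply lies `T`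
-- above the highest pebble below `a`; any pebble above `a` is at least `T + T` from that one in
-- both segments, hence at least `T` from the reply.
extend : ∀ T Ps → 0 < T → Pairwise (T + T) Ps → (0 , 0) ∈ Ps → ∀ a → ∃ λ a' → ∀ {Q} → Q ∈ Ps → Close T (a , a') Q
extend T Ps 0<T close origin∈ a with any? (near? T a) Ps
... | yes near with find near
...   | (b , b') , P∈ , a≤ , b≤ = a' , λ Q∈ → exact-close (a , a') (b , b') _ exact a≤ b≤ (close P∈ Q∈)
  where
  -- The subtraction is not truncated: comparison with the origin gives `b = b'`, or `b' ≥ 2T` while
  -- `b ≤ a + T`, or `b = 0`.
  a' = a + b' ∸ b
  b≤a+b' : b ≤ a + b'
  b≤a+b' with close origin∈ P∈
  ... | inj₁ e = ≤-trans (≤-reflexive (sym e)) (m≤n+m b' a)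
  ... | inj₂ (inj₁ (_ , 2T≤b')) = ≤-trans b≤ (+-monoʳ-≤ a (≤-trans (m≤m+n T T) 2T≤b'))
  ... | inj₂ (inj₂ (b+2T≤0 , _)) = ≤-trans (≤-trans (m≤m+n b _) b+2T≤0) z≤n
  exact : a + b' ≡ a' + b
  exact = sym (m∸n+n≡m b≤a+b')
extend T Ps 0<T close origin∈ a | no ¬near with highest-below a (0 , 0) Ps z≤n
... | (b , b') , P∈' , b≤a , maxP = b' + T , far
  where
  P∈ : (b , b') ∈ Ps
  P∈ = ∈-absorb origin∈ P∈'
  b+T≤a : b + T ≤ a
  b+T≤a = <⇒≤ (≰⇒> λ a≤b+T → ¬near (lose P∈ (a≤b+T , ≤-trans b≤a (m≤m+n a T))))
  far : ∀ {Q} → Q ∈ Ps → Close T (a , b' + T) Q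
  far {c , c'} Q∈ with ≤-total c a
  ... | inj₁ c≤a = inj₂ (inj₂ (≤-trans (+-monoˡ-≤ T c≤b) b+T≤a , +-monoˡ-≤ T c'≤b'))
    where
    c≤b = maxP (there Q∈) c≤a
    c'≤b' = Close-≤ (≤-trans 0<T (m≤m+n T T)) (close Q∈ P∈) c≤b
  ... | inj₂ a≤c = inj₂ (inj₁ (a+T≤c , subst (_≤ c') (sym (+-assoc b' T T)) b'+2T≤c'))
    where
    a+T≤c : a + T ≤ c
    a+T≤c = <⇒≤ (≰⇒> λ c≤a+T → ¬near (lose Q∈ (≤-trans a≤c (m≤m+n c T) , c≤a+T)))
    b+2T≤c : b + (T + T) ≤ c
    b+2T≤c = ≤-trans (≤-reflexive (sym (+-assoc b T T))) (≤-trans (+-monoˡ-≤ T b+T≤a) a+T≤c)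
    b'+2T≤c' : b' + (T + T) ≤ c'
    b'+2T≤c' with close P∈ Q∈
    ... | inj₂ (inj₁ (_ , l)) = l
    ... | inj₂ (inj₂ (h , _)) = ⊥-elim (<-irrefl refl
      (≤-trans (≤-trans (m<m+n c (≤-trans 0<T (m≤m+n T T))) h) (≤-trans (m≤m+n b _) b+2T≤c)))
    ... | inj₁ e = +-cancelʳ-≤ b _ _ (begin
      b' + (T + T) + b ≡⟨ trans (+-assoc b' _ b) (cong (b' +_) (+-comm _ b)) ⟩
      b' + (b + (T + T)) ≤⟨ +-monoʳ-≤ b' b+2T≤c ⟩
      b' + c ≡⟨ sym e ⟩
      b + c' ≡⟨ +-comm b c' ⟩
      c' + b ∎)
      where open ≤-Reasoning

-- Frames containing a path

record Surroundings : Set₁ where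
  field
    Rest       : Set
    _⟶_        : Rest → Rest → Set
    left right : Rest

module _ (X : Surroundings) where
  open Surroundings X

  -- Path points see their neighbours, and the outermost ones also see `left` and `right`; the rest
  -- never sees the path.
  PathR : ∀ m → (Rest ⊎ Fin m) → (Rest ⊎ Fin m) → Set
  PathR m (inj₁ x) (inj₁ y) = x ⟶ y
  PathR m (inj₁ x) (inj₂ j) = ⊥
  PathR m (inj₂ i) (inj₁ y) = (toℕ i ≡ 0 × y ≡ left) ⊎ (suc (toℕ i) ≡ m × y ≡ right)
  PathR m (inj₂ i) (inj₂ j) = suc (toℕ i) ≡ toℕ j ⊎ suc (toℕ j) ≡ toℕ i

  withPath : ℕ → Frame
  withPath m = record { W = Rest ⊎ Fin m ; w₀ = inj₁ left ; R = PathR m }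

-- At least 2, since Apart pebbles must not be adjacent.
threshold : ℕ → ℕ
threshold zero    = 2
threshold (suc k) = threshold k + threshold k

2≤threshold : ∀ k → 2 ≤ threshold k
2≤threshold zero    = ≤-refl
2≤threshold (suc k) = ≤-trans (2≤threshold k) (m≤m+n _ _)

module PathGame (X : Surroundings) where
  open Surroundings X

  -- Position i of the path is coded by suc i; the pebbles (0 , 0) and (suc m , suc m') mark its two ends.
  Corresponds : ∀ {m m'} → List Pebbles → Rest ⊎ Fin m → Rest ⊎ Fin m' → Set
  Corresponds Ps (inj₁ x) (inj₁ y) = x ≡ y
  Corresponds Ps (inj₂ i) (inj₂ j) = (suc (toℕ i) , suc (toℕ j)) ∈ Ps
  Corresponds Ps _        _        = ⊥

  -- Points off the path are answered by themselves, so the game reduces to the one on two segments.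
  record Sim (m m' k : ℕ) {n} (g : Fin n → Rest ⊎ Fin m) (g' : Fin n → Rest ⊎ Fin m') : Set where
    field
      pebbles : List Pebbles
      close   : Pairwise (threshold k) pebbles
      start∈  : (0 , 0) ∈ pebbles
      end∈    : (suc m , suc m') ∈ pebbles
      corr    : ∀ i → Corresponds pebbles (g i) (g' i)

  Corresponds-swap : ∀ {m m'} Ps (w : Rest ⊎ Fin m) (w' : Rest ⊎ Fin m') →
                     Corresponds Ps w w' → Corresponds (List.map swap Ps) w' w
  Corresponds-swap Ps (inj₁ x) (inj₁ y) e = sym e
  Corresponds-swap Ps (inj₂ i) (inj₂ j) h = ∈-map⁺ swap h

  Sim-sym : ∀ {m m' k n} {g : Fin n → Rest ⊎ Fin m} {g' : Fin n → Rest ⊎ Fin m'} → Sim m m' k g g' → Sim m' m k g' g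
  Sim-sym {k = k} {g = g} {g'} s = record
    { pebbles = List.map swap pebbles ; close = close'
    ; start∈ = ∈-map⁺ swap start∈ ; end∈ = ∈-map⁺ swap end∈
    ; corr = λ i → Corresponds-swap pebbles (g i) (g' i) (corr i) }
    where
    open Sim s
    close' : Pairwise (threshold k) (List.map swap pebbles)
    close' P∈ Q∈ with ∈-map⁻ swap P∈ | ∈-map⁻ swap Q∈
    ... | P , P∈' , refl | Q , Q∈' , refl = Close-swap P Q (close P∈' Q∈')

  module _ {m m' k n} {g : Fin n → Rest ⊎ Fin m} {g' : Fin n → Rest ⊎ Fin m'} (s : Sim m m' k g g') where
    open Sim s

    adjacent : ∀ {a a' b b'} → (a , a') ∈ pebbles → (b , b') ∈ pebbles → suc a ≡ b → suc a' ≡ b'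
    adjacent P∈ Q∈ = Close-suc (2≤threshold k) (close P∈ Q∈)

    -- Seeing `left` or `right` amounts to adjacency to an end pebble, so preservation of adjacency
    -- covers those edges too.
    Sim-R : ∀ i j → PathR X m (g i) (g j) → PathR X m' (g' i) (g' j)
    Sim-R i j with g i | g' i | g j | g' j | corr i | corr j
    ... | inj₁ x | inj₁ x' | inj₁ y | inj₁ y' | refl | refl = id
    ... | inj₂ a | inj₂ a' | inj₁ y | inj₁ y' | P∈ | refl = Sum.map
      (λ (e , y≡) → suc-injective (sym (adjacent start∈ P∈ (cong suc (sym e)))) , y≡)
      (λ (e , y≡) → suc-injective (adjacent P∈ end∈ (cong suc e)) , y≡)
    ... | inj₂ a | inj₂ a' | inj₂ b | inj₂ b' | P∈ | Q∈ = Sum.map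
      (λ e → suc-injective (adjacent P∈ Q∈ (cong suc e)))
      (λ e → suc-injective (adjacent Q∈ P∈ (cong suc e)))

    Sim-≡ : ∀ i j → g i ≡ g j → g' i ≡ g' j
    Sim-≡ i j e with g i | g' i | g j | g' j | corr i | corr j | e
    ... | inj₁ x | inj₁ x' | inj₁ y | inj₁ y' | refl | refl | refl = refl
    ... | inj₂ a | inj₂ a' | inj₂ b | inj₂ b' | P∈ | Q∈ | refl = cong inj₂ (toℕ-injective (suc-injective
      (≤-antisym (Close-≤ (≤-trans (s≤s z≤n) (2≤threshold k)) (close P∈ Q∈) ≤-refl)
                 (Close-≤ (≤-trans (s≤s z≤n) (2≤threshold k)) (close Q∈ P∈) ≤-refl))))

  Corresponds-there : ∀ {m m'} P Ps (w : Rest ⊎ Fin m) (w' : Rest ⊎ Fin m') → Corresponds Ps w w' → Corresponds (P ∷ Ps) w w'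
  Corresponds-there P Ps (inj₁ x) (inj₁ y) h = h
  Corresponds-there P Ps (inj₂ i) (inj₂ j) h = there h

  Sim-forth : ∀ {m m' k n} {g : Fin n → Rest ⊎ Fin m} {g' : Fin n → Rest ⊎ Fin m'} → Sim m m' (suc k) g g' →
              ∀ w → ∃ λ w' → Sim m m' k (consF w g) (consF w' g')
  Sim-forth {k = k} s (inj₁ x) = inj₁ x , record
    { pebbles = pebbles
    ; close = λ {P} {Q} P∈ Q∈ → Close-mono {P = P} {Q} (m≤m+n (threshold k) _) (close P∈ Q∈)
    ; start∈ = start∈ ; end∈ = end∈
    ; corr = λ { Fin.zero → refl ; (Fin.suc i) → corr i } }
    where open Sim s
  Sim-forth {m} {m'} {k} {g = g} {g'} s (inj₂ i) = reply (proj₁ extension) (proj₂ extension)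
    where
    open Sim s
    0<T : 0 < threshold k
    0<T = ≤-trans (s≤s z≤n) (2≤threshold k)
    extension = extend (threshold k) pebbles 0<T close start∈ (suc (toℕ i))
    reply : ∀ a' → (∀ {Q} → Q ∈ pebbles → Close (threshold k) (suc (toℕ i) , a') Q) →
            ∃ λ w' → Sim m m' k (consF (inj₂ i) g) (consF w' g')
    -- Order is preserved relative to the two end pebbles, so the reply falls strictly between them.
    reply zero    h = ⊥-elim (<-irrefl refl (Close-< 0<T (Close-sym (suc (toℕ i) , 0) (0 , 0) (h start∈)) (s≤s z≤n)))
    reply (suc b) h = inj₂ (fromℕ< b<m') , record
      { pebbles = (suc (toℕ i) , suc b) ∷ pebbles
      ; close = close'
      ; start∈ = there start∈ ; end∈ = there end∈
      ; corr = λ { Fin.zero → here (cong (λ c → suc (toℕ i) , suc c) (toℕ-fromℕ< b<m'))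
                 ; (Fin.suc j) → Corresponds-there _ pebbles (g j) (g' j) (corr j) } }
      where
      b<m' : b < m'
      b<m' = s≤s⁻¹ (Close-< 0<T (h end∈) (s≤s (toℕ<n i)))
      close' : Pairwise (threshold k) ((suc (toℕ i) , suc b) ∷ pebbles)
      close' (here refl) (here refl) = Close-refl (suc (toℕ i) , suc b)
      close' (here refl) (there Q∈)  = h Q∈
      close' (there {x = _} P∈) (here refl)  = Close-sym (suc (toℕ i) , suc b) _ (h P∈)
      close' {P} {Q} (there P∈) (there Q∈) = Close-mono {P = P} {Q} (m≤m+n (threshold k) _) (close P∈ Q∈)

  pathGame : ∀ m m' → Game (withPath X m) (withPath X m')
  pathGame m m' = record
    { Sim = Sim m m'
    ; rel⇒ = Sim-R ; rel⇐ = Sim-R ∘ Sim-sym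
    ; eq⇒ = Sim-≡ ; eq⇐ = Sim-≡ ∘ Sim-sym
    ; forth = Sim-forth
    ; back = λ s w' → let w , s' = Sim-forth (Sim-sym s) w' in w , Sim-sym s' }

  -- Initially only the ends are pebbled, and in both segments their distance reaches the threshold.
  stretch : ∀ m m' (θ : Sentence) (g : Fin 0 → Rest ⊎ Fin m) (g' : Fin 0 → Rest ⊎ Fin m') →
            threshold (rank θ) ≤ suc m → threshold (rank θ) ≤ suc m' →
            FrameSat (withPath X m) g θ → FrameSat (withPath X m') g' θ
  stretch m m' θ g g' T≤m T≤m' = Game.transfer⇒ (pathGame m m') θ ≤-refl (record
    { pebbles = (0 , 0) ∷ (suc m , suc m') ∷ [] ; close = close
    ; start∈ = here refl ; end∈ = there (here refl) ; corr = λ () })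
    where
    close : Pairwise (threshold (rank θ)) ((0 , 0) ∷ (suc m , suc m') ∷ [])
    close (here refl)         (here refl)         = inj₁ refl
    close (here refl)         (there (here refl)) = inj₂ (inj₁ (T≤m , T≤m'))
    close (there (here refl)) (here refl)         = inj₂ (inj₂ (T≤m , T≤m'))
    close (there (here refl)) (there (here refl)) = Close-refl (suc m , suc m')

-- An isomorphism answers any number of rounds, so its transfer of sentences is an instance of the
-- game.
isomorphismGame : ∀ (F F' : Frame) (f : Frame.W F' → Frame.W F) →
  (∀ {a b} → f a ≡ f b → a ≡ b) → (∀ w → ∃ λ a → w ≡ f a) →
  (∀ a b → Frame.R F (f a) (f b) → Frame.R F' a b) → (∀ a b → Frame.R F' a b → Frame.R F (f a) (f b)) →
  Game F F'
isomorphismGame F F' f inj surj R⇒ R⇐ = record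
  { Sim = λ _ g g' → ∀ i → g i ≡ f (g' i)
  ; rel⇒ = λ s i j r → R⇒ _ _ (subst₂ R (s i) (s j) r)
  ; rel⇐ = λ s i j r → subst₂ R (sym (s i)) (sym (s j)) (R⇐ _ _ r)
  ; eq⇒ = λ s i j e → inj (trans (sym (s i)) (trans e (s j)))
  ; eq⇐ = λ s i j e → trans (s i) (trans (cong f e) (sym (s j)))
  ; forth = λ s w → let a , e = surj w in a , λ { Fin.zero → e ; (Fin.suc i) → s i }
  ; back = λ s a → f a , λ { Fin.zero → refl ; (Fin.suc i) → s i } }
  where open Frame F

Dead : (F : Frame) → Frame.W F → Set
Dead F w = ∀ v → ¬ Frame.R F w v

-- A path between two dead ends

record DeadEndedPath (F : Frame) (j : ℕ) : Set where
  open Frame F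
  field
    nontrivial : 0 < j
    symmetric  : ∀ {w v u} → R w v → R v u → R v w
    ≤2         : ∀ {w y z u} → R w y → R w z → R w u → y ≡ z ⊎ y ≡ u ⊎ z ≡ u
    x          : ℕ → W
    x-step     : ∀ t → t < j → R (x t) (x (suc t))
    x-distinct : ∀ s t → s < t → t ≤ j → x s ≢ x t
    dl dr      : W
    step-dl    : R (x 0) dl
    dl-dead    : Dead F dl
    step-dr    : R (x j) dr
    dr-dead    : Dead F dr

module Decompose (lem : LEM) {F : Frame} {j : ℕ} (P : DeadEndedPath F j) where
  open Classical lem
  open Frame F
  open DeadEndedPath P

  successor : ∀ t → t ≤ j → ∃ (R (x t))
  successor t t≤j with m≤n⇒m<n∨m≡n t≤j
  ... | inj₁ t<j  = x (suc t) , x-step t t<j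
  ... | inj₂ refl = dr , step-dr

  not-dead : ∀ t {d} → t ≤ j → Dead F d → x t ≢ d
  not-dead t t≤j dead refl = let u , r = successor t t≤j in dead u r

  x-injective : ∀ {s t} → s ≤ j → t ≤ j → x s ≡ x t → s ≡ t
  x-injective {s} {t} s≤j t≤j e with <-cmp s t
  ... | tri< s<t _ _ = ⊥-elim (x-distinct s t s<t t≤j e)
  ... | tri≈ _ s≡t _ = s≡t
  ... | tri> _ _ t<s = ⊥-elim (x-distinct t s t<s s≤j (sym e))

  previous : ℕ → W
  previous zero    = dl
  previous (suc t) = x t

  step-previous : ∀ t → t ≤ j → R (x t) (previous t)
  step-previous zero    _   = step-dl
  step-previous (suc t) t<j = symmetric (x-step t t<j) (proj₂ (successor (suc t) t<j))

  previous≢next : ∀ t → t < j → previous t ≢ x (suc t)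
  previous≢next zero    0<j e = not-dead 1 0<j dl-dead (sym e)
  previous≢next (suc t) t<j e = x-distinct t (suc (suc t)) (≤-trans (n<1+n t) (n≤1+n (suc t))) t<j e

  -- For positive `t` the previous point is on the path and hence not dead. At `t = 0` it is `dl`,
  -- which may coincide with `dr`.
  previous≢dr : ∀ t → 0 < t → t ≤ j → previous t ≢ dr
  previous≢dr (suc t) _ t<j = not-dead t (<⇒≤ t<j) dr-dead

  Next : ℕ → W → Set
  Next t y = (t < j × y ≡ x (suc t)) ⊎ (t ≡ j × y ≡ dr)

  -- The previous and the next point are two distinct successors, and `≤2` excludes a third.
  successors : ∀ t {y} → t ≤ j → R (x t) y → y ≡ previous t ⊎ Next t y
  successors t t≤j r with m≤n⇒m<n∨m≡n t≤j
  ... | inj₁ t<j with ≤2 r (step-previous t t≤j) (x-step t t<j)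
  ...   | inj₁ e        = inj₁ e
  ...   | inj₂ (inj₁ e) = inj₂ (inj₁ (t<j , e))
  ...   | inj₂ (inj₂ e) = ⊥-elim (previous≢next t t<j e)
  successors t t≤j r | inj₂ refl with ≤2 r (step-previous t t≤j) step-dr
  ...   | inj₁ e        = inj₁ e
  ...   | inj₂ (inj₁ e) = inj₂ (inj₂ (refl , e))
  ...   | inj₂ (inj₂ e) = ⊥-elim (previous≢dr t nontrivial t≤j e)

  -- Irrelevance of avoids makes points off the path equal as soon as they are equal in W.
  record OffPath : Set where
    constructor off
    field
      point   : W
      .avoids : ∀ t → t ≤ j → x t ≢ point

  open OffPath using (point)

  surroundings : Surroundings
  surroundings = record
    { Rest = OffPath ; _⟶_ = λ o o' → R (point o) (point o')
    ; left = off dl λ t t≤j → not-dead t t≤j dl-dead ; right = off dr λ t t≤j → not-dead t t≤j dr-dead }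

  Split : Frame
  Split = withPath surroundings (suc j)

  embed : OffPath ⊎ Fin (suc j) → W
  embed (inj₁ o) = point o
  embed (inj₂ i) = x (toℕ i)

  on-path : ∀ (i : Fin (suc j)) → toℕ i ≤ j
  on-path i = s≤s⁻¹ (toℕ<n i)

  avoided : ∀ o t → t ≤ j → x t ≢ point o
  avoided (off _ avoids) t t≤j e = ⊥-elim-irr (avoids t t≤j e)

  off-≡ : ∀ {o o'} → point o ≡ point o' → o ≡ o'
  off-≡ refl = refl

  embed-injective : ∀ {a b} → embed a ≡ embed b → a ≡ b
  embed-injective {inj₁ o} {inj₁ o'} e = cong inj₁ (off-≡ e)
  embed-injective {inj₁ o} {inj₂ i}  e = ⊥-elim (avoided o (toℕ i) (on-path i) (sym e))
  embed-injective {inj₂ i} {inj₁ o}  e = ⊥-elim (avoided o (toℕ i) (on-path i) e)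
  embed-injective {inj₂ i} {inj₂ i'} e = cong inj₂ (toℕ-injective (x-injective (on-path i) (on-path i') e))

  embed-surjective : ∀ w → ∃ λ a → w ≡ embed a
  embed-surjective w with em (∃ λ t → t ≤ j × x t ≡ w)
  ... | inj₁ (t , t≤j , e) = inj₂ (fromℕ< (s≤s t≤j)) , trans (sym e) (cong x (sym (toℕ-fromℕ< (s≤s t≤j))))
  ... | inj₂ none          = inj₁ (off w λ t t≤j e → none (t , t≤j , e)) , refl

  from-path-off : ∀ t o → t ≤ j → R (x t) (point o) → (t ≡ 0 × point o ≡ dl) ⊎ (t ≡ j × point o ≡ dr)
  from-path-off t o t≤j r with successors t t≤j r
  from-path-off zero    o _ r | inj₁ e = inj₁ (refl , e)
  from-path-off (suc t) o t<j r | inj₁ e = ⊥-elim (avoided o t (<⇒≤ t<j) (sym e))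
  ... | inj₂ (inj₁ (t<j , e)) = ⊥-elim (avoided o (suc t) t<j (sym e))
  ... | inj₂ (inj₂ e)         = inj₂ e

  R⇒ : ∀ a b → R (embed a) (embed b) → Frame.R Split a b
  R⇒ (inj₁ o) (inj₁ o') r = r
  -- Path points are not dead, so an edge into the path can be reversed; its source would then be
  -- `dl` or `dr`, which have no successors.
  R⇒ (inj₁ o) (inj₂ i)  r
    with from-path-off (toℕ i) o (on-path i) (symmetric r (proj₂ (successor (toℕ i) (on-path i))))
  ... | inj₁ (_ , refl) = dl-dead _ r
  ... | inj₂ (_ , refl) = dr-dead _ r
  R⇒ (inj₂ i) (inj₁ o) r =
    Sum.map (λ (e , e') → e , off-≡ e') (λ (e , e') → cong suc e , off-≡ e') (from-path-off (toℕ i) o (on-path i) r)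
  R⇒ (inj₂ i) (inj₂ i') r = adjacent (toℕ i) (on-path i) r
    where
    adjacent : ∀ t → t ≤ j → R (x t) (x (toℕ i')) → suc t ≡ toℕ i' ⊎ suc (toℕ i') ≡ t
    adjacent t t≤j r with successors t t≤j r
    adjacent zero    _   r | inj₁ e = ⊥-elim (not-dead (toℕ i') (on-path i') dl-dead e)
    adjacent (suc t) t<j r | inj₁ e = inj₂ (cong suc (x-injective (on-path i') (<⇒≤ t<j) e))
    ... | inj₂ (inj₁ (t<j , e)) = inj₁ (sym (x-injective (on-path i') t<j e))
    ... | inj₂ (inj₂ (_ , e))   = ⊥-elim (not-dead (toℕ i') (on-path i') dr-dead e)

  R⇐ : ∀ a b → Frame.R Split a b → R (embed a) (embed b)
  R⇐ (inj₁ o) (inj₁ o') r = r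
  R⇐ (inj₂ i) (inj₁ o) (inj₁ (e , refl)) = subst (λ t → R (x t) dl) (sym e) step-dl
  R⇐ (inj₂ i) (inj₁ o) (inj₂ (e , refl)) = subst (λ t → R (x t) dr) (sym (suc-injective e)) step-dr
  R⇐ (inj₂ i) (inj₂ i') (inj₁ e) =
    subst (λ t → R (x (toℕ i)) (x t)) e (x-step (toℕ i) (subst (_≤ j) (sym e) (on-path i')))
  R⇐ (inj₂ i) (inj₂ i') (inj₂ e) =
    subst (λ t → R (x t) (x (toℕ i'))) e (step-previous (suc (toℕ i')) (subst (_≤ j) (sym e) (on-path i)))

  splitting : Game F Split
  splitting = isomorphismGame F Split embed (λ {a} {b} → embed-injective {a} {b}) embed-surjective R⇒ R⇐

  stretched : ℕ → Frame
  stretched = withPath surroundings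

  stretched-sat : ∀ m (θ : Sentence) (g : Fin 0 → W) (g' : Fin 0 → Frame.W (stretched m)) →
                  threshold (rank θ) ≤ suc (suc j) → threshold (rank θ) ≤ suc m →
                  FrameSat F g θ → FrameSat (stretched m) g' θ
  stretched-sat m θ g g' T≤ T≤' h = PathGame.stretch surroundings (suc j) m θ (λ ()) g' T≤ T≤'
    (Game.transfer⇒ splitting {k = rank θ} θ {g} {λ ()} ≤-refl (λ ()) h)

-- Modal formulas about paths

prop : ℕ → Fm
prop i = atom 0 i []

◇_ : Fm → Fm
◇ φ = ~ □ ~ φ

dead : Fm
dead = □ (prop 0 ∧' ~ prop 0)

reachesDead : ℕ → Fm
reachesDead zero    = dead
reachesDead (suc i) = ◇ reachesDead i

-- The Brouwerian axiom, relativized to successors that are not dead.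
symmetry : Fm
symmetry = prop 0 ⇒ □ (~ dead ⇒ ◇ prop 0)

-- A form of the axiom Alt₂: two letters suffice to separate three successors.
atMostTwo : Fm
atMostTwo = ~ (◇ prop 0 ∧' ◇ (~ prop 0 ∧' prop 1) ∧' ◇ (~ prop 0 ∧' ~ prop 1))

parity : ℕ → Fm
parity b = ~ (reachesDead 1 ∧' reachesDead (suc b * 2))

noneBelow : ℕ → Fm
noneBelow zero    = ~ (prop 0 ∧' ~ prop 0)
noneBelow (suc i) = ~ prop i ∧' noneBelow i

-- The letters i, i + 1, …, i + j distinguish the points of the walk.
walk : ℕ → ℕ → Fm
walk i zero    = (prop i ∧' noneBelow i) ∧' reachesDead 1
walk i (suc j) = (prop i ∧' noneBelow i) ∧' ◇ walk (suc i) j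

deadEndedWalk : ℕ → Fm
deadEndedWalk j = reachesDead 1 ∧' walk 0 j

-- The one-element domain makes this a propositional Kripke model with valuation `V`.
valued : (F : Frame) → (ℕ → Frame.W F → Set) → Model F
valued F V = record
  { U = ⊤ ; D = λ _ _ → ⊤ ; D-ne = λ _ → tt , tt ; D-mono = λ _ _ → tt
  ; I = λ { w zero k [] → V k w ; w (suc _) k xs → ⊥ } ; I-dom = λ _ _ → tt }

trivialValued : (F : Frame) → Model F
trivialValued F = valued F λ _ _ → ⊥

no-letters : ℕ → ⊤
no-letters _ = tt

module _ {F : Frame} (M : Model F) (g : ℕ → Model.U M) where
  open Frame F

  sat-◇ : ∀ w v φ → R w v → Sat M v g φ → Sat M w g (◇ φ)
  sat-◇ w v φ r s h = h v r s

  sat-dead : ∀ w → Dead F w → Sat M w g dead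
  sat-dead w d v r = ⊥-elim (d v r)

  sat-dead⁻ : ∀ w → Sat M w g dead → Dead F w
  sat-dead⁻ w s v r = let p , ¬p = s v r in ¬p p

  module _ (lem : LEM) where
    open Classical lem

    sat-◇⁻ : ∀ {w} φ → Sat M w g (◇ φ) → ∃ λ v → R w v × Sat M v g φ
    sat-◇⁻ φ s = dne λ none → s λ v r t → none (v , r , t)

    ReachesDeadEnd : W → Set
    ReachesDeadEnd w = ∃ λ d → R w d × Dead F d

    sat-reachesDead⁻ : ∀ {w} → Sat M w g (reachesDead 1) → ReachesDeadEnd w
    sat-reachesDead⁻ s = let d , r , t = sat-◇⁻ dead s in d , r , sat-dead⁻ d t

    sat-noneBelow⁻ : ∀ {w} i → Sat M w g (noneBelow i) → ∀ t → t < i → ¬ Sat M w g (prop t)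
    sat-noneBelow⁻ (suc i) (¬p , s) t (s≤s t≤i) with m≤n⇒m<n∨m≡n t≤i
    ... | inj₁ t<i  = sat-noneBelow⁻ i s t t<i
    ... | inj₂ refl = ¬p

    First : ℕ → W → Set
    First i w = Sat M w g (prop i) × (∀ t → t < i → ¬ Sat M w g (prop t))

    record Walk (i j : ℕ) (w : W) : Set where
      field
        x       : ℕ → W
        start   : x 0 ≡ w
        x-step  : ∀ t → t < j → R (x t) (x (suc t))
        x-first : ∀ t → t ≤ j → First (i + t) (x t)
        end     : ReachesDeadEnd (x j)

    sat-walk⁻ : ∀ i j {w} → Sat M w g (walk i j) → Walk i j w
    sat-walk⁻ i zero {w} ((p , none) , end) = record
      { x = λ _ → w ; start = refl ; x-step = λ _ ()
      ; x-first = λ { zero _ → subst (λ k → First k w) (sym (+-identityʳ i)) (p , sat-noneBelow⁻ i none) }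
      ; end = sat-reachesDead⁻ end }
    sat-walk⁻ i (suc j) {w} ((p , none) , s) with sat-◇⁻ (walk (suc i) j) s
    ... | v , r , t = record
      { x = w ∷ₐ x ; start = refl
      ; x-step = λ { zero _ → subst (R w) (sym start) r ; (suc t) (s≤s t<j) → x-step t t<j }
      ; x-first = λ { zero _ → subst (λ k → First k w) (sym (+-identityʳ i)) (p , sat-noneBelow⁻ i none)
                    ; (suc t) (s≤s t≤j) → subst (λ k → First k (x t)) (sym (+-suc i t)) (x-first t t≤j) }
      ; end = end }
      where open Walk (sat-walk⁻ (suc i) j t)

  -- The point `x s` satisfies letter `s`, whereas `x t` satisfies no letter below `t`.
  walk-distinct : (lem : LEM) → ∀ {j w} (X : Walk lem 0 j w) → let open Walk X in ∀ s t → s < t → t ≤ j → x s ≢ x t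
  walk-distinct lem X s t s<t t≤j e =
    proj₂ (x-first t t≤j) s s<t (subst (λ w → Sat M w g (prop s)) e (proj₁ (x-first s (≤-trans (<⇒≤ s<t) t≤j))))
    where open Walk X

-- Letter 0 is made true at `w` alone, so that seeing it again means seeing `w`.
valid-symmetry : LEM → ∀ F → ValidOn F symmetry → let open Frame F in ∀ {w v u} → R w v → R v u → R v w
valid-symmetry lem F valid {w} {v} {u} r r' = dne λ ¬back →
  valid M w no-letters (λ _ → tt)
    (refl , λ □ψ → □ψ v r ((λ d → sat-dead⁻ M no-letters v d u r') , λ ¬◇p → ¬◇p λ { z rz refl → ¬back rz }))
  where
  open Classical lem
  M = valued F λ _ → _≡ w

valid-atMostTwo : LEM → ∀ F → ValidOn F atMostTwo → let open Frame F in
                  ∀ {w y z u} → R w y → R w z → R w u → y ≡ z ⊎ y ≡ u ⊎ z ≡ u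
valid-atMostTwo lem F valid {w} {y} {z} {u} ry rz ru = dne λ distinct →
  valid M w no-letters (λ _ → tt)
    ( sat-◇ M no-letters w y (prop 0) ry refl
    , sat-◇ M no-letters w z (~ prop 0 ∧' prop 1) rz ((λ z≡y → distinct (inj₁ (sym z≡y))) , refl)
    , sat-◇ M no-letters w u (~ prop 0 ∧' ~ prop 1) ru
        ((λ u≡y → distinct (inj₂ (inj₁ (sym u≡y)))) , (λ u≡z → distinct (inj₂ (inj₂ (sym u≡z))))))
  where
  open Classical lem
  V : ℕ → Frame.W F → Set
  V zero    = _≡ y
  V (suc _) = _≡ z
  M = valued F V

-- Validity on the paths of even length

evenPath-symmetric : ∀ {w v u} → let open Frame evenPathFrame in R w v → R v u → R v w
evenPath-symmetric {O (suc a) b} {E _ _} (true , refl) _ = false , refl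
evenPath-symmetric {O a (suc b)} {E _ _} (false , refl) _ = true , refl
evenPath-symmetric {O zero b} (true , refl) (_ , ())
evenPath-symmetric {O a zero} (false , refl) (_ , ())
evenPath-symmetric {E (suc a) (suc b)} (true , refl) _ = false , refl
evenPath-symmetric {E (suc a) (suc b)} (false , refl) _ = true , refl

symmetry-in : LogicOf EvenPathClass symmetry
symmetry-in _ refl M w g _ (p , ¬□ψ) = ¬□ψ λ v r (¬dead , ¬◇p) →
  ¬dead λ u r' → ⊥-elim (¬◇p λ h → h w (evenPath-symmetric r r') p)

atMostTwo-in : LogicOf EvenPathClass atMostTwo
atMostTwo-in _ refl M w g _ (◇y , ◇z , ◇u) =
  ◇y λ { y (b , ey) py → ◇z λ { z (c , ez) (¬pz , qz) → ◇u λ { u (d , eu) (¬pu , ¬qu) →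
    pigeonhole b c d ey ez eu py ¬pz qz ¬pu ¬qu } } }
  where
  P Q : Position → Set
  P v = Sat M v g (prop 0)
  Q v = Sat M v g (prop 1)
  same : ∀ {b y z} → move w b ≡ just y → move w b ≡ just z → y ≡ z
  same e e' with trans (sym e) e'
  ... | refl = refl
  pigeonhole : ∀ b c d {y z u} → move w b ≡ just y → move w c ≡ just z → move w d ≡ just u →
               P y → ¬ P z → Q z → ¬ P u → ¬ Q u → ⊥
  pigeonhole true  true  _     ey ez eu py ¬pz qz ¬pu ¬qu = ¬pz (subst P (same ey ez) py)
  pigeonhole false false _     ey ez eu py ¬pz qz ¬pu ¬qu = ¬pz (subst P (same ey ez) py)
  pigeonhole true  false true  ey ez eu py ¬pz qz ¬pu ¬qu = ¬pu (subst P (same ey eu) py)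
  pigeonhole false true  false ey ez eu py ¬pz qz ¬pu ¬qu = ¬pu (subst P (same ey eu) py)
  pigeonhole true  false false ey ez eu py ¬pz qz ¬pu ¬qu = ¬qu (subst Q (same ez eu) qz)
  pigeonhole false true  true  ey ez eu py ¬pz qz ¬pu ¬qu = ¬qu (subst Q (same ez eu) qz)

even : ℕ → Bool
even zero    = true
even (suc i) = not (even i)

evenPosition : Position → Bool
evenPosition (E _ _) = true
evenPosition (O _ _) = false

move-parity : ∀ {w v} → Frame.R evenPathFrame w v → evenPosition w ≡ not (evenPosition v)
move-parity {O a b} (true , refl)  = refl
move-parity {O a b} (false , refl) = refl
move-parity {E (suc a) (suc b)} (true , refl)  = refl
move-parity {E (suc a) (suc b)} (false , refl) = refl

-- Dead worlds are even positions, and every step changes parity.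
reachesDead-parity : LEM → (M : Model evenPathFrame) → ∀ g i {w} → Sat M w g (reachesDead i) → evenPosition w ≡ even i
reachesDead-parity lem M g zero {E _ _} _ = refl
reachesDead-parity lem M g zero {O a b} s = ⊥-elim (sat-dead⁻ M g (O a b) s _ (true , refl))
reachesDead-parity lem M g (suc i) s =
  let v , r , t = sat-◇⁻ M g lem (reachesDead i) s
  in trans (move-parity r) (cong not (reachesDead-parity lem M g i t))

even-double : ∀ b → even (b * 2) ≡ true
even-double zero    = refl
even-double (suc b) = trans (Bool.not-involutive _) (even-double b)

parity-in : LEM → ∀ b → LogicOf EvenPathClass (parity b)
parity-in lem b _ refl M w g _ (s , t)
  with trans (sym (reachesDead-parity lem M g 1 s))
             (trans (reachesDead-parity lem M g (suc b * 2) t) (even-double (suc b)))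
... | ()

deadEndedWalk-consistent : ∀ b → ¬ LogicOf EvenPathClass (~ deadEndedWalk (b * 2))
deadEndedWalk-consistent b valid =
  valid _ refl M (O 0 b) no-letters (λ _ → tt) (sat-end (O 0 b) (E 0 (suc b)) (true , refl) (λ { _ (_ , ()) }) , sat-O 0 b)
  where
  index : Position → ℕ
  index (E a b) = a * 2
  index (O a b) = suc (a * 2)
  -- Letter `t` marks distance `t + 1` from the left end, so the walk starting next to that end
  -- meets the letters in order.
  M = valued evenPathFrame λ t w → index w ≡ suc t
  sat-end : ∀ w d → Frame.R evenPathFrame w d → Dead evenPathFrame d → Sat M w no-letters (reachesDead 1)
  sat-end w d r dd = sat-◇ M no-letters w d dead r (sat-dead M no-letters d dd)
  sat-noneBelow : ∀ w k i → i ≤ k → index w ≡ suc k → Sat M w no-letters (noneBelow i)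
  sat-noneBelow w k zero    _   e = λ (p , ¬p) → ¬p p
  sat-noneBelow w k (suc i) i<k e =
    (λ e' → <-irrefl (suc-injective (trans (sym e') e)) i<k) , sat-noneBelow w k i (<⇒≤ i<k) e
  sat-O : ∀ a b → Sat M (O a b) no-letters (walk (a * 2) (b * 2))
  sat-E : ∀ a b → Sat M (E (suc a) (suc b)) no-letters (walk (suc (a * 2)) (suc (b * 2)))
  sat-O a zero    = (refl , sat-noneBelow (O a 0) (a * 2) (a * 2) ≤-refl refl) ,
    sat-end (O a 0) (E (suc a) 0) (false , refl) λ { _ (_ , ()) }
  sat-O a (suc b) = (refl , sat-noneBelow (O a (suc b)) (a * 2) (a * 2) ≤-refl refl) ,
    sat-◇ M no-letters (O a (suc b)) (E (suc a) (suc b)) (walk (suc (a * 2)) (suc (b * 2))) (false , refl) (sat-E a b)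
  sat-E a b = (refl , sat-noneBelow (E (suc a) (suc b)) (suc (a * 2)) (suc (a * 2)) ≤-refl refl) ,
    sat-◇ M no-letters (E (suc a) (suc b)) (O (suc a) b) (walk (suc a * 2) (b * 2)) (false , refl) (sat-O (suc a) b)

-- Failure of parity on a stretched path

module _ (X : Surroundings) where
  open Surroundings X

  path-reachesDead : ∀ m → (∀ y → ¬ right ⟶ y) → ∀ k (i : Fin m) → toℕ i + suc k ≡ m →
    Sat (trivialValued (withPath X m)) (inj₂ i) no-letters (reachesDead (suc k))
  path-reachesDead m right-dead zero i e =
    sat-◇ M no-letters (inj₂ i) (inj₁ right) dead (inj₂ (trans (sym (+-comm (toℕ i) 1)) e , refl))
      (sat-dead M no-letters (inj₁ right) λ { (inj₁ y) r → right-dead y r ; (inj₂ _) () })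
    where M = trivialValued (withPath X m)
  path-reachesDead m right-dead (suc k) i e =
    sat-◇ M no-letters (inj₂ i) (inj₂ next') (reachesDead (suc k)) (inj₁ (sym next≡))
      (path-reachesDead m right-dead k next' (trans (cong (_+ suc k) next≡) (trans (sym (+-suc (toℕ i) (suc k))) e)))
    where
    M = trivialValued (withPath X m)
    i+1<m : suc (toℕ i) < m
    i+1<m = subst (suc (toℕ i) <_) e
      (subst (_≤ toℕ i + suc (suc k)) (+-comm (toℕ i) 2) (+-monoʳ-≤ (toℕ i) (s≤s (s≤s z≤n))))
    next' : Fin m
    next' = fromℕ< i+1<m
    next≡ : toℕ next' ≡ suc (toℕ i)
    next≡ = toℕ-fromℕ< i+1<m

  -- From the first path point the left dead end is one step away and the right one `2b + 2` steps.
  odd-path-refutes-parity : ∀ b → (∀ y → ¬ left ⟶ y) → (∀ y → ¬ right ⟶ y) →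
                            ¬ ValidOn (withPath X (suc b * 2)) (parity b)
  odd-path-refutes-parity b left-dead right-dead valid =
    valid M (inj₂ Fin.zero) no-letters (λ _ → tt)
      ( sat-◇ M no-letters (inj₂ Fin.zero) (inj₁ left) dead (inj₁ (refl , refl))
          (sat-dead M no-letters (inj₁ left) λ { (inj₁ y) r → left-dead y r ; (inj₂ _) () })
      , path-reachesDead (suc b * 2) right-dead (suc (b * 2)) Fin.zero refl )
    where M = trivialValued (withPath X (suc b * 2))

not-elementary : LEM → ¬ ElementarilyComplete (LogicOf EvenPathClass)
not-elementary lem (θ , L≐) = deadEndedWalk-consistent b (proj₂ (L≐ (~ deadEndedWalk (b * 2))) no-walk)
  where
  -- With this `b`, the given path of `2b + 1` points and its lengthening to `2b + 2` points both
  -- reach the threshold.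
  b = threshold (rank θ)
  T≤ : b ≤ suc (suc (b * 2))
  T≤ = ≤-trans (m≤m*n b 2) (≤-trans (n≤1+n _) (n≤1+n _))
  valid : ∀ φ → LogicOf EvenPathClass φ → ∀ F → FrameSat F (λ ()) θ → ValidOn F φ
  valid φ h F Fθ = proj₁ (L≐ φ) h F (lift Fθ)
  no-walk : LogicOf (Elementary θ) (~ deadEndedWalk (b * 2))
  no-walk F (lift Fθ) M w g g∈D (s , t) =
    -- The stretched frame still satisfies `θ`, so it must validate `parity b`, which its longer
    -- path refutes; hence no `θ`-frame satisfies the walk formula.
    odd-path-refutes-parity surroundings b (λ y → dl-dead _) (λ y → dr-dead _)
      (valid (parity b) (parity-in lem b) (stretched (suc b * 2))
        (stretched-sat (suc b * 2) θ _ _ T≤ (≤-trans T≤ (n≤1+n _)) Fθ))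
    where
    module X = Walk (sat-walk⁻ M g lem 0 (b * 2) t)
    left-end  = sat-reachesDead⁻ M g lem s
    right-end = X.end
    path : DeadEndedPath F (b * 2)
    path = record
      { nontrivial = ≤-trans (≤-trans (s≤s z≤n) (2≤threshold (rank θ))) (m≤m*n b 2)
      ; symmetric = valid-symmetry lem F (valid symmetry symmetry-in F Fθ)
      ; ≤2 = valid-atMostTwo lem F (valid atMostTwo atMostTwo-in F Fθ)
      ; x = X.x ; x-step = X.x-step ; x-distinct = walk-distinct M g lem (sat-walk⁻ M g lem 0 (b * 2) t)
      ; dl = proj₁ left-end ; dr = proj₁ right-end
      ; step-dl = subst (λ v → Frame.R F v _) (sym X.start) (proj₁ (proj₂ left-end))
      ; dl-dead = proj₂ (proj₂ left-end)
      ; step-dr = proj₁ (proj₂ right-end)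
      ; dr-dead = proj₂ (proj₂ right-end) }
    open Decompose lem path
    open DeadEndedPath path using (dl-dead; dr-dead)

≐-elementary : ∀ {a b} {L : Fm → Set a} {L' : Fm → Set b} → L ≐ L' → ElementarilyComplete L → ElementarilyComplete L'
≐-elementary eqv (θ , L≐) = θ , λ φ → proj₁ (L≐ φ) ∘ proj₂ (eqv φ) , proj₁ (eqv φ) ∘ proj₂ (L≐ φ)

theorem2 : Σ (ℕ → Maybe Fm) λ e →
    LEM → NormalLogic (Enumerated e) × KripkeComplete (Enumerated e) × ¬ ElementarilyComplete (Enumerated e)
theorem2 = enumeration , λ lem →
    ≐-normal (enumerates-logic lem) (LogicOf-normal lem EvenPathClass)
  , (EvenPathClass , enumerates-logic lem)
  , λ elementary → not-elementary lem (≐-elementary (enumerates-logic lem) elementary)
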